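{- Let $k\ge2$ and $\ell\ge0$. Among all stable configurations reachable by labeled chip-firing from $k^\ell$ chips labeled $1,\dots,k^\ell$ at the root of the infinite rooted directed $k$-ary tree (viewed as permutations of $\{1,\dots,k^\ell\}$), the permutation $Z_k(\ell)$ has the maximum number of inversions, and this maximum number of inversions is $$\frac{k^{2\ell}-\ell k^{\ell+1}+(\ell-1)k^{\ell}}{4}.$$
   Context: Labeled chip-firing on the infinite rooted directed $k$-ary tree (each vertex has $k$ children ordered left to right, root on layer $1$): a vertex with at least $k$ chips may fire by choosing any $k$ of its chips and sending the $i$-th smallest label among them to its $i$-th leftmost child; a configuration is stable when no vertex has $\ge k$ chips. Starting with $k^\ell$ chips at the root, every stable configuration has exactly one chip on each vertex of layer $\ell+1$ and none elsewhere, and is identified with the permutation of labels read left to right on layer $\ell+1$. $Z_k(\ell)$ is the stable configuration obtained by the strategy in which every vertex on layers $1,\dots,\ell$, holding chips $c_1<\cdots<c_{kq}$, fires the $k$-tuples of consecutive chips $(c_1,\dots,c_k),(c_{k+1},\dots,c_{2k}),\dots$ in sorted order; equivalently, its $p$-th entry is $1+\mathrm{rev}_{k,\ell}(p-1)$, where $\mathrm{rev}_{k,\ell}$ reverses the $\ell$-digit (zero-padded) base-$k$ representation. An inversion of a permutation $\pi$ is a pair $i<j$ with $\pi_i>\pi_j$. -}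

module Defs where

open import Data.Nat as ℕ using (ℕ; zero; suc; _^_; NonZero)
open import Data.Nat.DivMod using (_mod_)
open import Data.Fin as Fin using (Fin; remQuot)
open import Data.Fin.Properties as Fin using ()
open import Data.Fin.Permutation using (Permutation′; _⟨$⟩ʳ_)
open import Data.List using (List; []; _∷_; _∷ʳ_; length; filter; allFin; cartesianProduct)
open import Data.List.Properties using (≡-dec)
open import Data.Product using (_,_)
open import Relation.Nullary.Decidable using (_×-dec_)
open import Relation.Binary.PropositionalEquality using (_≡_; _≢_)
open import Relation.Binary.Construct.Closure.ReflexiveTransitive using (Star)

-- A vertex of the infinite rooted k-ary tree is the path leading to it: the
-- list of child indices read from the root downwards.  The root is [], the
-- i-th leftmost child of v is v ∷ʳ i, and v lies on layer 1 + length v.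
Vertex : ℕ → Set
Vertex k = List (Fin k)

-- The chip x : Fin n carries the label 1 + toℕ x.
Config : ℕ → ℕ → Set
Config k n = Fin n → Vertex k

module _ {k n : ℕ} where

  -- Listed in increasing order of label.
  chipsAt : Config k n → Vertex k → List (Fin n)
  chipsAt c v = filter (λ x → ≡-dec Fin._≟_ (c x) v) (allFin n)

  record Fires (c c′ : Config k n) : Set where
    field
      vertex     : Vertex k
      chips      : Fin k → Fin n
      increasing : ∀ {i j} → i Fin.< j → chips i Fin.< chips j
      present    : ∀ i → c (chips i) ≡ vertex
      sent       : ∀ i → c′ (chips i) ≡ vertex ∷ʳ i
      unmoved    : ∀ x → (∀ i → chips i ≢ x) → c′ x ≡ c x

  initial : Config k n
  initial _ = []

  Reachable : Config k n → Set
  Reachable = Star Fires initial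

  Stable : Config k n → Set
  Stable c = ∀ v → length (chipsAt c v) ℕ.< k

  -- Number of chips smaller than x on the vertex that holds x.
  rank : Config k n → Fin n → ℕ
  rank c x = length (filter (Fin._<? x) (chipsAt c (c x)))

  -- Every vertex holding chips fires all of them, in consecutive k-tuples of
  -- its sorted chips: the chip of (zero-based) rank q * k + i is the i-th
  -- smallest of the (zero-based) q-th tuple, hence goes to child i.  This describes legal
  -- firing only when each vertex holds a multiple of k chips.
  fireConsecutive : .{{_ : NonZero k}} → Config k n → Config k n
  fireConsecutive c x = c x ∷ʳ (rank c x mod k)

  -- After m rounds all chips lie on layer m + 1, so round m + 1 fires exactly
  -- the vertices of that layer.
  consecutiveRounds : .{{_ : NonZero k}} → ℕ → Config k n
  consecutiveRounds zero    = initial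
  consecutiveRounds (suc m) = fireConsecutive (consecutiveRounds m)

Z : (k ℓ : ℕ) .{{_ : NonZero k}} → Config k (k ^ ℓ)
Z k ℓ = consecutiveRounds ℓ

-- The p-th vertex from the left on layer ℓ + 1 (p zero-based); its path is the
-- ℓ-digit base-k representation of p, most significant digit first.
vertexOnLayer : (k ℓ : ℕ) → Fin (k ^ ℓ) → Vertex k
vertexOnLayer k zero    p = []
vertexOnLayer k (suc ℓ) p with remQuot {k} (k ^ ℓ) p
... | d , r = d ∷ vertexOnLayer k ℓ r

-- Since π is a bijection onto the set of all chips, this says that c has
-- exactly one chip on each vertex of layer ℓ + 1 and none elsewhere, and that
-- reading that layer from left to right gives π.
ReadsAs : (k ℓ : ℕ) → Config k (k ^ ℓ) → Permutation′ (k ^ ℓ) → Set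
ReadsAs k ℓ c π = ∀ p → c (π ⟨$⟩ʳ p) ≡ vertexOnLayer k ℓ p

inversions : ∀ {n} → Permutation′ n → ℕ
inversions {n} π =
  length (filter (λ (i , j) → (i Fin.<? j) ×-dec ((π ⟨$⟩ʳ j) Fin.<? (π ⟨$⟩ʳ i)))
                 (cartesianProduct (allFin n) (allFin n)))

{-# OPTIONS --safe #-}
module Submission where

-- Let Nᵢ(t) count the chips with label ≤ t below the i-th child of a vertex v. A
-- firing at v sends its sorted chips to the children from left to right, so
-- Nᵢ(t) ≥ Nⱼ(t) for i < j, and all children receive equally many chips, in every
-- reachable configuration. Equal counts force a stable configuration to have one
-- chip on each vertex of layer ℓ + 1. An inversion is charged to the vertex where
-- the paths of its two chips part; if q chips lie below each child of v, the
-- inequality leaves at most C(q, 2) inversions between the i-th and j-th subtrees,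
-- with equality when moreover Nᵢ(t) ≤ Nⱼ(t) + 1. In Z the chips below a vertex are
-- the labels with prescribed lowest base-k digits, so the chips below two
-- siblings alternate and equality holds everywhere.

open import Data.Nat as ℕ using (ℕ; zero; suc; _+_; _*_; _^_; _≤_; _<_; z≤n; s≤s; NonZero)
open import Data.Nat.Properties as ℕ hiding (_≟_)
open import Data.Nat.Solver using (module +-*-Solver)
open import Data.Integer as ℤ using ()
open import Data.Integer.Properties as ℤ using ()
import Data.Integer.Solver as ℤ-Solver
open import Data.Rational as ℚ using ()
open import Data.Rational.Properties as ℚ using ()
open import Data.Rational.Unnormalised using (mkℚᵘ; *≡*)
open import Data.Bool using (if_then_else_)
open import Data.Nat.DivMod
open import Data.Nat.Divisibility using (divides; ∣⇒≤)
open import Data.Fin as Fin using (Fin; zero; suc; toℕ; combine; _↑ˡ_; _↑ʳ_)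
open import Data.Fin.Properties as Fin using (_≟_; toℕ-injective; toℕ<n)
open import Data.Fin.Permutation as Perm using (Permutation′; _⟨$⟩ʳ_)
open import Data.List using (List; []; _∷_; _++_; _∷ʳ_; length; filter; tabulate; allFin; cartesianProduct; map)
open import Data.List.Properties using (≡-dec; ∷-injective; length-++; filter-++; map-tabulate; ++-identityʳ; ∷ʳ-++)
open import Data.Product using (Σ-syntax; ∃; _×_; _,_; proj₁; proj₂)
open import Data.Sum using (inj₁; inj₂)
open import Function using (_∘_; id)
open import Function.Definitions using (Injective)
open import Relation.Nullary using (Dec; yes; no; does; ¬_; contradiction)
open import Relation.Nullary.Decidable using (_×-dec_)
open import Relation.Unary using (Decidable)
open import Relation.Binary using (tri<; tri≈; tri>)
open import Relation.Binary.PropositionalEquality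
open import Relation.Binary.Construct.Closure.ReflexiveTransitive using (Star; ε; _◅_; _◅◅_)
open import Algebra.Properties.Semiring.Sum +-*-semiring
  using (sum; sum-cong-≗; ∑-distrib-+; ∑-comm; sum-permute; *-distribˡ-sum; *-distribʳ-sum; sum-syntax)
open import Defs

-- Indicators and finite sums

𝟙 : ∀ {a} {A : Set a} → Dec A → ℕ
𝟙 A? = if does A? then 1 else 0

𝟙-yes : ∀ {a} {A : Set a} (A? : Dec A) → A → 𝟙 A? ≡ 1
𝟙-yes (yes _) _ = refl
𝟙-yes (no ¬a) a = contradiction a ¬a

𝟙-no : ∀ {a} {A : Set a} (A? : Dec A) → ¬ A → 𝟙 A? ≡ 0
𝟙-no (yes a) ¬a = contradiction a ¬a
𝟙-no (no _)  _  = refl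

𝟙-mono : ∀ {a b} {A : Set a} {B : Set b} (A? : Dec A) (B? : Dec B) → (A → B) → 𝟙 A? ≤ 𝟙 B?
𝟙-mono (yes a) B? f = ≤-reflexive (sym (𝟙-yes B? (f a)))
𝟙-mono (no _)  B? f = z≤n

𝟙-cong : ∀ {a b} {A : Set a} {B : Set b} (A? : Dec A) (B? : Dec B) → (A → B) → (B → A) → 𝟙 A? ≡ 𝟙 B?
𝟙-cong A? B? f g = ≤-antisym (𝟙-mono A? B? f) (𝟙-mono B? A? g)

𝟙-× : ∀ {a b} {A : Set a} {B : Set b} (A? : Dec A) (B? : Dec B) → 𝟙 (A? ×-dec B?) ≡ 𝟙 A? * 𝟙 B?
𝟙-× (yes _) B? = sym (+-identityʳ _)
𝟙-× (no _)  B? = refl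

𝟙≤1 : ∀ {a} {A : Set a} (A? : Dec A) → 𝟙 A? ≤ 1
𝟙≤1 (yes _) = ≤-refl
𝟙≤1 (no _)  = z≤n

length-filter-tabulate : ∀ {a p} {A : Set a} {P : A → Set p} (P? : Decidable P) {n} (f : Fin n → A) →
                         length (filter P? (tabulate f)) ≡ ∑[ i < n ] 𝟙 (P? (f i))
length-filter-tabulate P? {zero}  f = refl
length-filter-tabulate P? {suc n} f with P? (f zero)
... | yes _ = cong suc (length-filter-tabulate P? (f ∘ suc))
... | no _  = length-filter-tabulate P? (f ∘ suc)

length-filter-filter : ∀ {a p q} {A : Set a} {P : A → Set p} {Q : A → Set q}
                       (P? : Decidable P) (Q? : Decidable Q) xs →
                       length (filter Q? (filter P? xs)) ≡ length (filter (λ x → P? x ×-dec Q? x) xs)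
length-filter-filter P? Q? []       = refl
length-filter-filter P? Q? (x ∷ xs) with P? x
... | no _  = length-filter-filter P? Q? xs
... | yes _ with Q? x
...   | yes _ = cong suc (length-filter-filter P? Q? xs)
...   | no _  = length-filter-filter P? Q? xs

length-filter-cartesianProduct :
  ∀ {a b p} {A : Set a} {B : Set b} {P : A × B → Set p} (P? : Decidable P)
  {m n} (f : Fin m → A) (g : Fin n → B) →
  length (filter P? (cartesianProduct (tabulate f) (tabulate g))) ≡ ∑[ i < m ] ∑[ j < n ] 𝟙 (P? (f i , g j))
length-filter-cartesianProduct P? {zero}  f g = refl
length-filter-cartesianProduct P? {suc m} {n} f g = begin
  length (filter P? (row ++ rest))                    ≡⟨ cong length (filter-++ P? row rest) ⟩
  length (filter P? row ++ filter P? rest)            ≡⟨ length-++ (filter P? row) ⟩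
  length (filter P? row) + length (filter P? rest)    ≡⟨ cong₂ _+_ row-length (length-filter-cartesianProduct P? (f ∘ suc) g) ⟩
  ∑[ i < suc m ] ∑[ j < n ] 𝟙 (P? (f i , g j))        ∎
  where
  open ≡-Reasoning
  row  = map (f zero ,_) (tabulate g)
  rest = cartesianProduct (tabulate (f ∘ suc)) (tabulate g)
  row-length : length (filter P? row) ≡ ∑[ j < n ] 𝟙 (P? (f zero , g j))
  row-length = trans (cong (length ∘ filter P?) (map-tabulate g (f zero ,_)))
                     (length-filter-tabulate P? (λ j → f zero , g j))

sum-const : ∀ n c → ∑[ i < n ] c ≡ n * c
sum-const zero    c = refl
sum-const (suc n) c = cong (c +_) (sum-const n c)

sum-zero : ∀ {n} {f : Fin n → ℕ} → (∀ i → f i ≡ 0) → sum f ≡ 0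
sum-zero {n} f≡0 = trans (sum-cong-≗ f≡0) (trans (sum-const n 0) (*-zeroʳ n))

sum-↑ : ∀ m {n} (f : Fin (m + n) → ℕ) →
        sum f ≡ ∑[ i < m ] f (i ↑ˡ n) + ∑[ j < n ] f (m ↑ʳ j)
sum-↑ zero    f = refl
sum-↑ (suc m) f = trans (cong (f zero +_) (sum-↑ m (f ∘ suc))) (sym (+-assoc (f zero) _ _))

sum-combine : ∀ m {n} (f : Fin (m * n) → ℕ) → sum f ≡ ∑[ i < m ] ∑[ j < n ] f (combine i j)
sum-combine zero        f = refl
sum-combine (suc m) {n} f =
  trans (sum-↑ n f) (cong (∑[ j < n ] f (j ↑ˡ m * n) +_) (sum-combine m (λ p → f (n ↑ʳ p))))

sum-𝟙-≟ : ∀ {n} (a : Fin n) (h : Fin n → ℕ) → ∑[ i < n ] (𝟙 (i ≟ a) * h i) ≡ h a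
sum-𝟙-≟ {suc n} zero    h =
  trans (cong₂ _+_ (+-identityʳ (h zero)) (sum-zero {n} (λ _ → refl))) (+-identityʳ (h zero))
sum-𝟙-≟ {suc n} (suc a) h = trans
  (sum-cong-≗ λ i → cong (_* h (suc i)) (𝟙-cong (suc i ≟ suc a) (i ≟ a) Fin.suc-injective (cong suc)))
  (sum-𝟙-≟ a (h ∘ suc))

-- An arbitrary relation in place of `_≤_`, since `inversionCount-step` sums the same comparisons
-- once as inequalities and once as equations.
sum-mono : ∀ {n} {_∼_ : ℕ → ℕ → Set} → 0 ∼ 0 → (∀ {a b c d} → a ∼ b → c ∼ d → (a + c) ∼ (b + d)) →
           {f g : Fin n → ℕ} → (∀ i → f i ∼ g i) → sum f ∼ sum g
sum-mono {zero}  0∼0 +-mono f∼g = 0∼0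
sum-mono {suc n} {_∼_} 0∼0 +-mono f∼g = +-mono (f∼g zero) (sum-mono {n} {_∼_} 0∼0 +-mono (f∼g ∘ suc))

sum-mono-≤ : ∀ {n} {f g : Fin n → ℕ} → (∀ i → f i ≤ g i) → sum f ≤ sum g
sum-mono-≤ = sum-mono {_∼_ = _≤_} ≤-refl +-mono-≤

sum≢0⇒∃ : ∀ {n} {p} {P : Fin n → Set p} (P? : Decidable P) → ∑[ i < n ] 𝟙 (P? i) ≢ 0 → ∃ P
sum≢0⇒∃ P? ≢0 with Fin.any? P?
... | yes ∃P = ∃P
... | no ¬∃P = contradiction (sum-zero (λ i → 𝟙-no (P? i) (λ p → ¬∃P (i , p)))) ≢0

-- By trichotomy each of the n² index pairs is ascending, descending or diagonal, and the first two
-- kinds are equally many. This is n(n - 1)/2 without division or subtraction.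
sum-pairs : ∀ {m n} (f : Fin n → Fin m) → Injective _≡_ _≡_ f →
            2 * ∑[ i < n ] ∑[ j < n ] 𝟙 (f i Fin.<? f j) + n ≡ n * n
sum-pairs {m} {n} f f-inj = begin
  2 * S + n
    ≡⟨ cong₂ _+_ (cong (S +_) (trans (+-identityʳ S) (∑-comm {n} {n} (λ i j → 𝟙 (f i Fin.<? f j)))))
                 (sym diagonal) ⟩
  S + (∑[ i < n ] ∑[ j < n ] 𝟙 (f j Fin.<? f i)) + (∑[ i < n ] ∑[ j < n ] (𝟙 (j ≟ i) * 1))
    ≡⟨ cong (_+ (∑[ i < n ] ∑[ j < n ] (𝟙 (j ≟ i) * 1))) (∑-distrib-+ {n} _ _) ⟨
  (∑[ i < n ] ((∑[ j < n ] 𝟙 (f i Fin.<? f j)) + (∑[ j < n ] 𝟙 (f j Fin.<? f i)))) + (∑[ i < n ] ∑[ j < n ] (𝟙 (j ≟ i) * 1))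
    ≡⟨ ∑-distrib-+ {n} _ _ ⟨
  ∑[ i < n ] (((∑[ j < n ] 𝟙 (f i Fin.<? f j)) + (∑[ j < n ] 𝟙 (f j Fin.<? f i))) + (∑[ j < n ] (𝟙 (j ≟ i) * 1)))
    ≡⟨ sum-cong-≗ {n} (λ i → trans (cong (_+ (∑[ j < n ] (𝟙 (j ≟ i) * 1))) (sym (∑-distrib-+ {n} _ _)))
                                   (sym (∑-distrib-+ {n} _ _))) ⟩
  ∑[ i < n ] ∑[ j < n ] ((𝟙 (f i Fin.<? f j) + 𝟙 (f j Fin.<? f i)) + 𝟙 (j ≟ i) * 1)
    ≡⟨ sum-cong-≗ {n} (λ i → sum-cong-≗ {n} (trichotomy i)) ⟩
  ∑[ i < n ] ∑[ j < n ] 1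
    ≡⟨ sum-cong-≗ {n} (λ i → trans (sum-const n 1) (*-identityʳ n)) ⟩
  ∑[ i < n ] n
    ≡⟨ sum-const n n ⟩
  n * n ∎
  where
  open ≡-Reasoning
  S = ∑[ i < n ] ∑[ j < n ] 𝟙 (f i Fin.<? f j)
  diagonal : ∑[ i < n ] ∑[ j < n ] (𝟙 (j ≟ i) * 1) ≡ n
  diagonal = trans (sum-cong-≗ {n} (λ i → sum-𝟙-≟ i (λ _ → 1))) (trans (sum-const n 1) (*-identityʳ n))
  trichotomy : ∀ i j → (𝟙 (f i Fin.<? f j) + 𝟙 (f j Fin.<? f i)) + 𝟙 (j ≟ i) * 1 ≡ 1
  trichotomy i j with Fin.<-cmp (f i) (f j)
  ... | tri< a b c rewrite 𝟙-yes (f i Fin.<? f j) a | 𝟙-no (f j Fin.<? f i) c | 𝟙-no (j ≟ i) (b ∘ cong f ∘ sym) = refl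
  ... | tri≈ a b c rewrite 𝟙-no (f i Fin.<? f j) a | 𝟙-no (f j Fin.<? f i) c | 𝟙-yes (j ≟ i) (sym (f-inj b)) = refl
  ... | tri> a b c rewrite 𝟙-no (f i Fin.<? f j) a | 𝟙-yes (f j Fin.<? f i) c | 𝟙-no (j ≟ i) (b ∘ cong f ∘ sym) = refl

-- Inversions and crossings between blocks

∑∑-distrib-+ : ∀ {m n} (f g : Fin m → Fin n → ℕ) →
               ∑[ i < m ] ∑[ j < n ] (f i j + g i j) ≡ ∑[ i < m ] ∑[ j < n ] f i j + ∑[ i < m ] ∑[ j < n ] g i j
∑∑-distrib-+ {m} f g = trans (sum-cong-≗ {m} (λ i → ∑-distrib-+ (f i) (g i))) (∑-distrib-+ {m} _ _)

-- The pairs (r , s) that become inversions when the block f stands to the left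
-- of the block g.
cross : ∀ {q n} → (Fin q → Fin n) → (Fin q → Fin n) → ℕ
cross {q} f g = ∑[ s < q ] ∑[ r < q ] 𝟙 (g s Fin.<? f r)

module _ {q n} (f g : Fin q → Fin n) (g-inj : Injective _≡_ _≡_ g) where

  private
    below : ℕ
    below = ∑[ s < q ] ∑[ s′ < q ] 𝟙 (g s′ Fin.<? g s)

    2*below+q : 2 * below + q ≡ q * q
    2*below+q = trans (cong (λ x → 2 * x + q) (∑-comm {q} {q} (λ s s′ → 𝟙 (g s′ Fin.<? g s)))) (sum-pairs g g-inj)

    noncross : ℕ
    noncross = ∑[ s < q ] ∑[ r < q ] 𝟙 (f r Fin.≤? g s)

    cross+noncross : cross f g + noncross ≡ q * q
    cross+noncross = begin
      cross f g + noncross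
        ≡⟨ ∑∑-distrib-+ {q} {q} _ _ ⟨
      ∑[ s < q ] ∑[ r < q ] (𝟙 (g s Fin.<? f r) + 𝟙 (f r Fin.≤? g s))
        ≡⟨ sum-cong-≗ {q} (λ s → sum-cong-≗ {q} (λ r → either (g s) (f r))) ⟩
      ∑[ s < q ] ∑[ r < q ] 1
        ≡⟨ sum-cong-≗ {q} (λ _ → trans (sum-const q 1) (*-identityʳ q)) ⟩
      ∑[ s < q ] q
        ≡⟨ sum-const q q ⟩
      q * q ∎
      where
      open ≡-Reasoning
      either : (x y : Fin n) → 𝟙 (x Fin.<? y) + 𝟙 (y Fin.≤? x) ≡ 1
      either x y with <-≤-connex (toℕ x) (toℕ y)
      ... | inj₁ x<y rewrite 𝟙-yes (x Fin.<? y) x<y | 𝟙-no (y Fin.≤? x) (<⇒≱ x<y) = refl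
      ... | inj₂ y≤x rewrite 𝟙-no (x Fin.<? y) (≤⇒≯ y≤x) | 𝟙-yes (y Fin.≤? x) y≤x = refl

    ∑-suc : ∀ (h : Fin q → ℕ) → ∑[ s < q ] suc (h s) ≡ q + sum h
    ∑-suc h = trans (∑-distrib-+ (λ _ → 1) h) (cong (_+ sum h) (trans (sum-const q 1) (*-identityʳ q)))

    rearrange : ∀ c m b → c + m ≡ q * q → 2 * b + q ≡ q * q → (2 * c + q) + 2 * m ≡ q * q + 2 * (q + b)
    rearrange c m b c+m b+q = begin
      (2 * c + q) + 2 * m     ≡⟨ solve 3 (λ c m q → (con 2 :* c :+ q) :+ con 2 :* m := con 2 :* (c :+ m) :+ q) refl c m q ⟩
      2 * (c + m) + q         ≡⟨ cong (λ x → 2 * x + q) c+m ⟩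
      2 * (q * q) + q         ≡⟨ solve 2 (λ x q → con 2 :* x :+ q := x :+ (x :+ q)) refl (q * q) q ⟩
      q * q + (q * q + q)     ≡⟨ cong (λ x → q * q + (x + q)) b+q ⟨
      q * q + (2 * b + q + q) ≡⟨ cong (q * q +_) (solve 2 (λ b q → con 2 :* b :+ q :+ q := con 2 :* (q :+ b)) refl b q) ⟩
      q * q + 2 * (q + b)     ∎
      where
      open ≡-Reasoning
      open +-*-Solver

    -- Here `q + below` is C(q + 1, 2), so this reads C(q, 2) - cross = noncross - C(q + 1, 2).
    -- Upper and lower bounds on crossings become lower and upper bounds on `noncross`, which is a
    -- sum of counts at the thresholds g s.
    balance : (2 * cross f g + q) + 2 * noncross ≡ q * q + 2 * (q + below)
    balance = rearrange (cross f g) noncross below cross+noncross 2*below+q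

  -- Take t = g s: at least as many f r as g s′ are ≤ g s, and the latter are g s itself together
  -- with the labels counted by `below`. Summing over s gives `q + below`.
  cross-≤ : (∀ t → ∑[ s < q ] 𝟙 (g s Fin.≤? t) ≤ ∑[ r < q ] 𝟙 (f r Fin.≤? t)) → 2 * cross f g + q ≤ q * q
  cross-≤ dominated = +-cancelʳ-≤ (2 * noncross) _ _ (begin
    (2 * cross f g + q) + 2 * noncross ≡⟨ balance ⟩
    q * q + 2 * (q + below)            ≤⟨ +-monoʳ-≤ (q * q) (*-monoʳ-≤ 2 q+below≤noncross) ⟩
    q * q + 2 * noncross               ∎)
    where
    open ≤-Reasoning
    split-≤ : ∀ s s′ → 𝟙 (s′ ≟ s) * 1 + 𝟙 (g s′ Fin.<? g s) ≡ 𝟙 (g s′ Fin.≤? g s)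
    split-≤ s s′ with Fin.<-cmp (g s′) (g s)
    ... | tri< a b c rewrite 𝟙-no (s′ ≟ s) (b ∘ cong g) | 𝟙-yes (g s′ Fin.<? g s) a | 𝟙-yes (g s′ Fin.≤? g s) (<⇒≤ a) = refl
    ... | tri≈ a b c rewrite 𝟙-yes (s′ ≟ s) (g-inj b) | 𝟙-no (g s′ Fin.<? g s) a
                             | 𝟙-yes (g s′ Fin.≤? g s) (Fin.≤-reflexive b) = refl
    ... | tri> a b c rewrite 𝟙-no (s′ ≟ s) (b ∘ cong g) | 𝟙-no (g s′ Fin.<? g s) a | 𝟙-no (g s′ Fin.≤? g s) (<⇒≱ c) = refl
    q+below≤noncross : q + below ≤ noncross
    q+below≤noncross = begin
      q + below
        ≡⟨ ∑-suc (λ s → ∑[ s′ < q ] 𝟙 (g s′ Fin.<? g s)) ⟨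
      ∑[ s < q ] suc (∑[ s′ < q ] 𝟙 (g s′ Fin.<? g s))
        ≡⟨ sum-cong-≗ {q} (λ s → cong (_+ (∑[ s′ < q ] 𝟙 (g s′ Fin.<? g s))) (sum-𝟙-≟ s (λ _ → 1))) ⟨
      ∑[ s < q ] (∑[ s′ < q ] (𝟙 (s′ ≟ s) * 1) + ∑[ s′ < q ] 𝟙 (g s′ Fin.<? g s))
        ≡⟨ sum-cong-≗ {q} (λ s → trans (sym (∑-distrib-+ {q} _ _)) (sum-cong-≗ {q} (split-≤ s))) ⟩
      ∑[ s < q ] ∑[ s′ < q ] 𝟙 (g s′ Fin.≤? g s)
        ≤⟨ sum-mono-≤ {q} (λ s → dominated (g s)) ⟩
      noncross ∎

  -- Again t = g s. Disjointness makes f r ≤ g s strict, and the hypothesis then bounds each count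
  -- in `noncross` by 1 plus the matching count in `below`.
  cross-≥ : (∀ r s → f r ≢ g s) →
            (∀ t → ∑[ r < q ] 𝟙 (f r Fin.<? t) ≤ suc (∑[ s < q ] 𝟙 (g s Fin.<? t))) → q * q ≤ 2 * cross f g + q
  cross-≥ disjoint alternating = +-cancelʳ-≤ (2 * noncross) _ _ (begin
    q * q + 2 * noncross               ≤⟨ +-monoʳ-≤ (q * q) (*-monoʳ-≤ 2 noncross≤q+below) ⟩
    q * q + 2 * (q + below)            ≡⟨ balance ⟨
    (2 * cross f g + q) + 2 * noncross ∎)
    where
    open ≤-Reasoning
    noncross≤q+below : noncross ≤ q + below
    noncross≤q+below = begin
      noncross
        ≡⟨ sum-cong-≗ {q} (λ s → sum-cong-≗ {q} (λ r →
             𝟙-cong (f r Fin.≤? g s) (f r Fin.<? g s) (λ fr≤gs → Fin.≤∧≢⇒< fr≤gs (disjoint r s)) <⇒≤)) ⟩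
      ∑[ s < q ] ∑[ r < q ] 𝟙 (f r Fin.<? g s)
        ≤⟨ sum-mono-≤ {q} (λ s → alternating (g s)) ⟩
      ∑[ s < q ] suc (∑[ s′ < q ] 𝟙 (g s′ Fin.<? g s))
        ≡⟨ ∑-suc (λ s → ∑[ s′ < q ] 𝟙 (g s′ Fin.<? g s)) ⟩
      q + below ∎

inversionCount : ∀ {m n} → (Fin m → Fin n) → ℕ
inversionCount {m} f = ∑[ i < m ] ∑[ j < m ] (𝟙 (i Fin.<? j) * 𝟙 (f j Fin.<? f i))

inversions≡inversionCount : ∀ {n} (π : Permutation′ n) → inversions π ≡ inversionCount (π ⟨$⟩ʳ_)
inversions≡inversionCount {n} π =
  trans (length-filter-cartesianProduct (λ (i , j) → (i Fin.<? j) ×-dec ((π ⟨$⟩ʳ j) Fin.<? (π ⟨$⟩ʳ i))) {n} {n} id id)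
        (sum-cong-≗ {n} (λ i → sum-cong-≗ {n} (λ j → 𝟙-× (i Fin.<? j) ((π ⟨$⟩ʳ j) Fin.<? (π ⟨$⟩ʳ i)))))

combine-<? : ∀ {m q} (d e : Fin m) (r s : Fin q) →
             𝟙 (combine d r Fin.<? combine e s) ≡ 𝟙 (e ≟ d) * 𝟙 (r Fin.<? s) + 𝟙 (d Fin.<? e)
combine-<? {m} {q} d e r s with Fin.<-cmp d e
... | tri< a b c rewrite 𝟙-no (e ≟ d) (b ∘ sym) | 𝟙-yes (d Fin.<? e) a =
  𝟙-yes (combine d r Fin.<? combine e s) (Fin.combine-monoˡ-< r s a)
... | tri> a b c rewrite 𝟙-no (e ≟ d) (b ∘ sym) | 𝟙-no (d Fin.<? e) a =
  𝟙-no (combine d r Fin.<? combine e s) (<-asym (Fin.combine-monoˡ-< s r c))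
... | tri≈ a refl c rewrite 𝟙-yes (e ≟ d) refl | 𝟙-no (d Fin.<? e) a =
  trans (𝟙-cong (combine d r Fin.<? combine e s) (r Fin.<? s)
           (λ lt → +-cancelˡ-< (q * toℕ d) _ _ (subst₂ _<_ (Fin.toℕ-combine d r) (Fin.toℕ-combine e s) lt))
           (λ lt → subst₂ _<_ (sym (Fin.toℕ-combine d r)) (sym (Fin.toℕ-combine e s)) (+-monoʳ-< (q * toℕ d) lt)))
        (sym (trans (+-identityʳ _) (+-identityʳ _)))

-- One level of the charging: positions are ordered lexicographically, so a pair with equal leading
-- digits is compared inside its block, while a pair with leading digits d < e parts at the root and
-- is counted by `cross`.
inversionCount-combine : ∀ {m q n} (f : Fin (m * q) → Fin n) →
  inversionCount f ≡ ∑[ d < m ] inversionCount (f ∘ combine d)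
                     + ∑[ d < m ] ∑[ e < m ] (𝟙 (d Fin.<? e) * cross (f ∘ combine d) (f ∘ combine e))
inversionCount-combine {m} {q} f = begin
  inversionCount f
    ≡⟨ sum-combine m _ ⟩
  ∑[ d < m ] ∑[ r < q ] ∑[ y < m * q ] (𝟙 (combine d r Fin.<? y) * 𝟙 (f y Fin.<? f (combine d r)))
    ≡⟨ sum-cong-≗ {m} (λ d → trans (sum-cong-≗ {q} (λ r → sum-combine m _)) (∑-comm {q} {m} _)) ⟩
  ∑[ d < m ] ∑[ e < m ] ∑[ r < q ] ∑[ s < q ] (𝟙 (combine d r Fin.<? combine e s) * X d e r s)
    ≡⟨ sum-cong-≗ {m} (λ d → sum-cong-≗ {m} (λ e → split d e)) ⟩
  ∑[ d < m ] ∑[ e < m ] (𝟙 (e ≟ d) * W d e + 𝟙 (d Fin.<? e) * cross (f ∘ combine d) (f ∘ combine e))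
    ≡⟨ ∑∑-distrib-+ {m} {m} _ _ ⟩
  (∑[ d < m ] ∑[ e < m ] (𝟙 (e ≟ d) * W d e)) + (∑[ d < m ] ∑[ e < m ] (𝟙 (d Fin.<? e) * cross (f ∘ combine d) (f ∘ combine e)))
    ≡⟨ cong (_+ (∑[ d < m ] ∑[ e < m ] (𝟙 (d Fin.<? e) * cross (f ∘ combine d) (f ∘ combine e))))
          (sum-cong-≗ {m} (λ d → sum-𝟙-≟ d (W d))) ⟩
  (∑[ d < m ] inversionCount (f ∘ combine d)) + (∑[ d < m ] ∑[ e < m ] (𝟙 (d Fin.<? e) * cross (f ∘ combine d) (f ∘ combine e))) ∎
  where
  open ≡-Reasoning
  X : Fin m → Fin m → Fin q → Fin q → ℕ
  X d e r s = 𝟙 (f (combine e s) Fin.<? f (combine d r))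
  W : Fin m → Fin m → ℕ
  W d e = ∑[ r < q ] ∑[ s < q ] (𝟙 (r Fin.<? s) * X d e r s)
  pull : ∀ c (h : Fin q → Fin q → ℕ) → ∑[ r < q ] ∑[ s < q ] (c * h r s) ≡ c * ∑[ r < q ] ∑[ s < q ] h r s
  pull c h = sym (trans (*-distribˡ-sum {q} c _) (sum-cong-≗ {q} (λ r → *-distribˡ-sum {q} c _)))
  split : ∀ d e → ∑[ r < q ] ∑[ s < q ] (𝟙 (combine d r Fin.<? combine e s) * X d e r s)
                  ≡ 𝟙 (e ≟ d) * W d e + 𝟙 (d Fin.<? e) * cross (f ∘ combine d) (f ∘ combine e)
  split d e = begin
    ∑[ r < q ] ∑[ s < q ] (𝟙 (combine d r Fin.<? combine e s) * X d e r s)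
      ≡⟨ sum-cong-≗ {q} (λ r → sum-cong-≗ {q} (λ s → trans (cong (_* X d e r s) (combine-<? d e r s))
           (trans (*-distribʳ-+ (X d e r s) (𝟙 (e ≟ d) * 𝟙 (r Fin.<? s)) (𝟙 (d Fin.<? e)))
                  (cong (_+ 𝟙 (d Fin.<? e) * X d e r s) (*-assoc (𝟙 (e ≟ d)) (𝟙 (r Fin.<? s)) (X d e r s)))))) ⟩
    ∑[ r < q ] ∑[ s < q ] (𝟙 (e ≟ d) * (𝟙 (r Fin.<? s) * X d e r s) + 𝟙 (d Fin.<? e) * X d e r s)
      ≡⟨ ∑∑-distrib-+ {q} {q} _ _ ⟩
    (∑[ r < q ] ∑[ s < q ] (𝟙 (e ≟ d) * (𝟙 (r Fin.<? s) * X d e r s))) + (∑[ r < q ] ∑[ s < q ] (𝟙 (d Fin.<? e) * X d e r s))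
      ≡⟨ cong₂ _+_ (pull (𝟙 (e ≟ d)) _)
           (trans (pull (𝟙 (d Fin.<? e)) (X d e)) (cong (𝟙 (d Fin.<? e) *_) (∑-comm {q} {q} (X d e)))) ⟩
    𝟙 (e ≟ d) * W d e + 𝟙 (d Fin.<? e) * cross (f ∘ combine d) (f ∘ combine e) ∎

-- Subtrees and blocks of leaves

_≟ᵥ_ : ∀ {k} (u v : Vertex k) → Dec (u ≡ v)
_≟ᵥ_ = ≡-dec _≟_

-- The prefix relation as a number, so that it can multiply a weight under a sum.
inSubtree : ∀ {k} → Vertex k → Vertex k → ℕ
inSubtree []      w       = 1
inSubtree (a ∷ v) []      = 0
inSubtree (a ∷ v) (b ∷ w) = 𝟙 (b ≟ a) * inSubtree v w

inSubtree-∷ʳ-[] : ∀ {k} (v : Vertex k) i → inSubtree (v ∷ʳ i) [] ≡ 0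
inSubtree-∷ʳ-[] []      i = refl
inSubtree-∷ʳ-[] (a ∷ v) i = refl

𝟙-∷-≟ᵥ : ∀ {k} (a b : Fin k) v w → 𝟙 ((b ∷ w) ≟ᵥ (a ∷ v)) ≡ 𝟙 (b ≟ a) * 𝟙 (w ≟ᵥ v)
𝟙-∷-≟ᵥ a b v w = trans (𝟙-cong ((b ∷ w) ≟ᵥ (a ∷ v)) ((b ≟ a) ×-dec (w ≟ᵥ v)) ∷-injective (λ (p , q) → cong₂ _∷_ p q))
                       (𝟙-× (b ≟ a) (w ≟ᵥ v))

-- Going down one edge from w adds a single new prefix, the endpoint itself, and the endpoint is v
-- ∷ʳ i only for w = v and m = i.
inSubtree-∷ʳ : ∀ {k} (v : Vertex k) i w m →
               inSubtree (v ∷ʳ i) (w ∷ʳ m) ≡ inSubtree (v ∷ʳ i) w + 𝟙 (w ≟ᵥ v) * 𝟙 (m ≟ i)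
inSubtree-∷ʳ []      i []      m = *-comm (𝟙 (m ≟ i)) 1
inSubtree-∷ʳ []      i (b ∷ w) m = sym (+-identityʳ _)
inSubtree-∷ʳ (a ∷ v) i []      m = trans (cong (𝟙 (m ≟ a) *_) (inSubtree-∷ʳ-[] v i)) (*-zeroʳ (𝟙 (m ≟ a)))
inSubtree-∷ʳ (a ∷ v) i (b ∷ w) m = begin
  𝟙 (b ≟ a) * inSubtree (v ∷ʳ i) (w ∷ʳ m)
    ≡⟨ cong (𝟙 (b ≟ a) *_) (inSubtree-∷ʳ v i w m) ⟩
  𝟙 (b ≟ a) * (inSubtree (v ∷ʳ i) w + 𝟙 (w ≟ᵥ v) * 𝟙 (m ≟ i))
    ≡⟨ *-distribˡ-+ (𝟙 (b ≟ a)) _ _ ⟩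
  𝟙 (b ≟ a) * inSubtree (v ∷ʳ i) w + 𝟙 (b ≟ a) * (𝟙 (w ≟ᵥ v) * 𝟙 (m ≟ i))
    ≡⟨ cong (𝟙 (b ≟ a) * inSubtree (v ∷ʳ i) w +_)
         (trans (cong (_* 𝟙 (m ≟ i)) (𝟙-∷-≟ᵥ a b v w)) (*-assoc (𝟙 (b ≟ a)) (𝟙 (w ≟ᵥ v)) (𝟙 (m ≟ i)))) ⟨
  𝟙 (b ≟ a) * inSubtree (v ∷ʳ i) w + 𝟙 ((b ∷ w) ≟ᵥ (a ∷ v)) * 𝟙 (m ≟ i) ∎
  where open ≡-Reasoning

inSubtree-children : ∀ {k} (v w : Vertex k) →
                     inSubtree v w ≡ 𝟙 (w ≟ᵥ v) + ∑[ i < k ] inSubtree (v ∷ʳ i) w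
inSubtree-children {k} []      []      = sym (cong suc (sum-zero {k} (λ i → refl)))
inSubtree-children {k} []      (b ∷ w) =
  sym (trans (sum-cong-≗ {k} (λ i → cong (_* 1) (𝟙-cong (b ≟ i) (i ≟ b) sym sym))) (sum-𝟙-≟ b (λ _ → 1)))
inSubtree-children {k} (a ∷ v) []      = sym (sum-zero {k} (λ i → refl))
inSubtree-children {k} (a ∷ v) (b ∷ w) = begin
  𝟙 (b ≟ a) * inSubtree v w
    ≡⟨ cong (𝟙 (b ≟ a) *_) (inSubtree-children v w) ⟩
  𝟙 (b ≟ a) * (𝟙 (w ≟ᵥ v) + ∑[ i < k ] inSubtree (v ∷ʳ i) w)
    ≡⟨ *-distribˡ-+ (𝟙 (b ≟ a)) _ _ ⟩
  𝟙 (b ≟ a) * 𝟙 (w ≟ᵥ v) + 𝟙 (b ≟ a) * (∑[ i < k ] inSubtree (v ∷ʳ i) w)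
    ≡⟨ cong₂ _+_ (sym (𝟙-∷-≟ᵥ a b v w)) (*-distribˡ-sum {k} (𝟙 (b ≟ a)) _) ⟩
  𝟙 ((b ∷ w) ≟ᵥ (a ∷ v)) + ∑[ i < k ] (𝟙 (b ≟ a) * inSubtree (v ∷ʳ i) w) ∎
  where open ≡-Reasoning

vertexOnLayer-combine : ∀ {k} ℓ (d : Fin k) r → vertexOnLayer k (suc ℓ) (combine d r) ≡ d ∷ vertexOnLayer k ℓ r
vertexOnLayer-combine {k} ℓ d r = cong (λ (e , s) → e ∷ vertexOnLayer k ℓ s) (Fin.remQuot-combine d r)

length-vertexOnLayer : ∀ k ℓ p → length (vertexOnLayer k ℓ p) ≡ ℓ
length-vertexOnLayer k zero    p = refl
length-vertexOnLayer k (suc ℓ) p = cong suc (length-vertexOnLayer k ℓ _)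

vertexOnLayer-injective : ∀ k ℓ → Injective _≡_ _≡_ (vertexOnLayer k ℓ)
vertexOnLayer-injective k zero    {zero} {zero} _ = refl
vertexOnLayer-injective k (suc ℓ) {p} {p′} eq
  with Fin.combine-surjective {k} {k ^ ℓ} p | Fin.combine-surjective {k} {k ^ ℓ} p′
... | d , r , refl | d′ , r′ , refl
  with ∷-injective (trans (sym (vertexOnLayer-combine ℓ d r)) (trans eq (vertexOnLayer-combine ℓ d′ r′)))
... | refl , eq′ = cong (combine d) (vertexOnLayer-injective k ℓ eq′)

-- The counterpart of `weightBelow` for weights on positions: descending to a child of the root
-- becomes restriction to a block of positions, which is what the induction on ℓ needs.
blockSum : ∀ {k} ℓ → (Fin (k ^ ℓ) → ℕ) → Vertex k → ℕ
blockSum {k} ℓ h v = ∑[ p < k ^ ℓ ] (h p * inSubtree v (vertexOnLayer k ℓ p))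

blockSum-∷ : ∀ {k} ℓ (h : Fin (k ^ suc ℓ) → ℕ) d v → blockSum (suc ℓ) h (d ∷ v) ≡ blockSum ℓ (h ∘ combine d) v
blockSum-∷ {k} ℓ h d v = begin
  blockSum (suc ℓ) h (d ∷ v)
    ≡⟨ sum-combine k _ ⟩
  ∑[ e < k ] ∑[ r < k ^ ℓ ] (h (combine e r) * inSubtree (d ∷ v) (vertexOnLayer k (suc ℓ) (combine e r)))
    ≡⟨ sum-cong-≗ {k} (λ e → sum-cong-≗ {k ^ ℓ} (λ r → term e r)) ⟩
  ∑[ e < k ] ∑[ r < k ^ ℓ ] (𝟙 (e ≟ d) * (h (combine e r) * inSubtree v (vertexOnLayer k ℓ r)))
    ≡⟨ sum-cong-≗ {k} (λ e → *-distribˡ-sum {k ^ ℓ} (𝟙 (e ≟ d)) _) ⟨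
  ∑[ e < k ] (𝟙 (e ≟ d) * blockSum ℓ (h ∘ combine e) v)
    ≡⟨ sum-𝟙-≟ d (λ e → blockSum ℓ (h ∘ combine e) v) ⟩
  blockSum ℓ (h ∘ combine d) v ∎
  where
  open ≡-Reasoning
  term : ∀ e r → h (combine e r) * inSubtree (d ∷ v) (vertexOnLayer k (suc ℓ) (combine e r))
                 ≡ 𝟙 (e ≟ d) * (h (combine e r) * inSubtree v (vertexOnLayer k ℓ r))
  term e r = trans (cong (λ w → h (combine e r) * inSubtree (d ∷ v) w) (vertexOnLayer-combine ℓ e r))
                   (solve 3 (λ x y z → x :* (y :* z) := y :* (x :* z)) refl (h (combine e r)) (𝟙 (e ≟ d)) _)
    where open +-*-Solver

blockSum-[i] : ∀ {k} ℓ (h : Fin (k ^ suc ℓ) → ℕ) d → blockSum (suc ℓ) h (d ∷ []) ≡ ∑[ r < k ^ ℓ ] h (combine d r)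
blockSum-[i] {k} ℓ h d = trans (blockSum-∷ ℓ h d []) (sum-cong-≗ {k ^ ℓ} (λ r → *-identityʳ _))

-- The comparison `≤ t` here and `< t` in `Alternating` are both deliberate. The thresholds used are
-- labels of the right-hand block: counting that label itself gains 1 per threshold in the lower
-- bound on `noncross`, and leaving it out saves 1 per threshold in the upper bound.
Dominated : ∀ k {n} ℓ → (Fin (k ^ ℓ) → Fin n) → Set
Dominated k {n} ℓ f = ∀ (v : Vertex k) {i j} → i Fin.< j → (t : Fin n) →
  blockSum ℓ (λ p → 𝟙 (f p Fin.≤? t)) (v ∷ʳ j) ≤ blockSum ℓ (λ p → 𝟙 (f p Fin.≤? t)) (v ∷ʳ i)

Alternating : ∀ k {n} ℓ → (Fin (k ^ ℓ) → Fin n) → Set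
Alternating k {n} ℓ f = ∀ (v : Vertex k) i j → (t : Fin n) →
  blockSum ℓ (λ p → 𝟙 (f p Fin.<? t)) (v ∷ʳ i) ≤ suc (blockSum ℓ (λ p → 𝟙 (f p Fin.<? t)) (v ∷ʳ j))

Dominated-block : ∀ {k n} ℓ (f : Fin (k ^ suc ℓ) → Fin n) → Dominated k (suc ℓ) f → ∀ d → Dominated k ℓ (f ∘ combine d)
Dominated-block ℓ f dom d v {i} {j} i<j t =
  subst₂ _≤_ (blockSum-∷ ℓ below d (v ∷ʳ j)) (blockSum-∷ ℓ below d (v ∷ʳ i)) (dom (d ∷ v) i<j t)
  where below = λ p → 𝟙 (f p Fin.≤? t)

Alternating-block : ∀ {k n} ℓ (f : Fin (k ^ suc ℓ) → Fin n) → Alternating k (suc ℓ) f → ∀ d → Alternating k ℓ (f ∘ combine d)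
Alternating-block ℓ f alt d v i j t =
  subst₂ _≤_ (blockSum-∷ ℓ below d (v ∷ʳ i)) (cong suc (blockSum-∷ ℓ below d (v ∷ʳ j))) (alt (d ∷ v) i j t)
  where below = λ p → 𝟙 (f p Fin.<? t)

combine-injective-block : ∀ m q {n} (f : Fin (m * q) → Fin n) → Injective _≡_ _≡_ f →
                          ∀ d → Injective _≡_ _≡_ (f ∘ combine {m} {q} d)
combine-injective-block m q f f-inj d {r} {s} eq = Fin.combine-injectiveʳ d r d s (f-inj eq)

-- Comparing every pair of blocks with C(q, 2) crossings, in either relation,
-- turns the splitting of inversions by leading digit into the recursion solved
-- by the closed formula; the terms are distributed so that nothing is
-- subtracted.
inversionCount-step :
  (_∼_ : ℕ → ℕ → Set) → (∀ {a} → a ∼ a) → (∀ {a b c d} → a ∼ b → c ∼ d → (a + c) ∼ (b + d)) →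
  ∀ {k q n} ℓ (f : Fin (k * q) → Fin n) →
  (∀ d → (4 * inversionCount (f ∘ combine d) + (ℓ * (k * q) + q)) ∼ (q * q + ℓ * q)) →
  (∀ d e → d Fin.< e → (2 * cross (f ∘ combine d) (f ∘ combine e) + q) ∼ (q * q)) →
  (4 * inversionCount f + (suc ℓ * (k * (k * q)) + k * q)) ∼ ((k * q) * (k * q) + suc ℓ * (k * q))
inversionCount-step _∼_ ∼-refl ∼-+ {k} {q} ℓ f within between =
  subst₂ _∼_ (lhs (sum-pairs {k} {k} id id)) (rhs (sum-pairs {k} {k} id id))
    -- `sum-between` enters twice because it bounds 2X where 4X is needed. As 2P + k = k², the k q
    -- inside `sum-within` completes the two P q to k² q; the added `k * q` restores the last term
    -- on the left and likewise completes ℓ to `suc ℓ` on the right.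
    (∼-+ (∼-+ sum-within (∼-+ sum-between sum-between)) (∼-refl {k * q}))
  where
  open ≡-Reasoning
  I X P : ℕ
  I = ∑[ d < k ] inversionCount (f ∘ combine d)
  X = ∑[ d < k ] ∑[ e < k ] (𝟙 (d Fin.<? e) * cross (f ∘ combine d) (f ∘ combine e))
  P = ∑[ d < k ] ∑[ e < k ] 𝟙 (d Fin.<? e)

  sum-affine : ∀ {n} (h : Fin n → ℕ) a b → ∑[ i < n ] (a * h i + b) ≡ a * sum h + n * b
  sum-affine {n} h a b = trans (∑-distrib-+ {n} _ _) (cong₂ _+_ (sym (*-distribˡ-sum {n} a h)) (sum-const n b))

  sum-within : (4 * I + k * (ℓ * (k * q) + q)) ∼ (k * (q * q + ℓ * q))
  sum-within = subst₂ _∼_ (sum-affine {k} _ 4 _) (sum-const k _) (sum-mono {k} {_∼_} ∼-refl ∼-+ within)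

  pair : ∀ d e → (2 * (𝟙 (d Fin.<? e) * cross (f ∘ combine d) (f ∘ combine e)) + 𝟙 (d Fin.<? e) * q) ∼ (𝟙 (d Fin.<? e) * (q * q))
  pair d e with Fin.<-cmp d e
  ... | tri< d<e _ _ rewrite 𝟙-yes (d Fin.<? e) d<e =
    subst₂ _∼_
      (cong₂ (λ x y → 2 * x + y) (sym (+-identityʳ (cross (f ∘ combine d) (f ∘ combine e)))) (sym (+-identityʳ q)))
      (sym (+-identityʳ (q * q))) (between d e d<e)
  ... | tri≈ d≮e _ _ rewrite 𝟙-no (d Fin.<? e) d≮e = ∼-refl
  ... | tri> d≮e _ _ rewrite 𝟙-no (d Fin.<? e) d≮e = ∼-refl

  sum-between : (2 * X + P * q) ∼ (P * (q * q))
  sum-between = subst₂ _∼_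
    (trans (∑∑-distrib-+ {k} {k} _ _)
           (cong₂ _+_ (sym (trans (*-distribˡ-sum {k} 2 _) (sum-cong-≗ {k} (λ d → *-distribˡ-sum {k} 2 _)))) (pairs q)))
    (pairs (q * q))
    (sum-mono {k} {_∼_} ∼-refl ∼-+ (λ d → sum-mono {k} {_∼_} ∼-refl ∼-+ (pair d)))
    where
    pairs : ∀ c → ∑[ d < k ] ∑[ e < k ] (𝟙 (d Fin.<? e) * c) ≡ P * c
    pairs c = sym (trans (*-distribʳ-sum {k} c _) (sum-cong-≗ {k} (λ d → *-distribʳ-sum {k} c _)))

  open +-*-Solver
  lhs : 2 * P + k ≡ k * k →
        4 * I + k * (ℓ * (k * q) + q) + ((2 * X + P * q) + (2 * X + P * q)) + k * q
        ≡ 4 * inversionCount f + (suc ℓ * (k * (k * q)) + k * q)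
  lhs 2P+k≡k² = begin
    4 * I + k * (ℓ * (k * q) + q) + ((2 * X + P * q) + (2 * X + P * q)) + k * q
      ≡⟨ solve 6 (λ I X P k q ℓ → con 4 :* I :+ k :* (ℓ :* (k :* q) :+ q)
                                    :+ ((con 2 :* X :+ P :* q) :+ (con 2 :* X :+ P :* q)) :+ k :* q
                   := con 4 :* (I :+ X) :+ (ℓ :* (k :* (k :* q)) :+ (con 2 :* P :+ k) :* q :+ k :* q)) refl I X P k q ℓ ⟩
    4 * (I + X) + (ℓ * (k * (k * q)) + (2 * P + k) * q + k * q)
      ≡⟨ cong₂ (λ x y → 4 * x + (ℓ * (k * (k * q)) + y * q + k * q)) (sym (inversionCount-combine {k} {q} f)) 2P+k≡k² ⟩
    4 * inversionCount f + (ℓ * (k * (k * q)) + k * k * q + k * q)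
      ≡⟨ cong (4 * inversionCount f +_) (solve 3 (λ k q ℓ → ℓ :* (k :* (k :* q)) :+ k :* k :* q :+ k :* q
                                              := (k :* (k :* q) :+ ℓ :* (k :* (k :* q))) :+ k :* q) refl k q ℓ) ⟩
    4 * inversionCount f + (suc ℓ * (k * (k * q)) + k * q) ∎

  rhs : 2 * P + k ≡ k * k →
        k * (q * q + ℓ * q) + (P * (q * q) + P * (q * q)) + k * q ≡ (k * q) * (k * q) + suc ℓ * (k * q)
  rhs 2P+k≡k² = begin
    k * (q * q + ℓ * q) + (P * (q * q) + P * (q * q)) + k * q
      ≡⟨ solve 4 (λ P k q ℓ → k :* (q :* q :+ ℓ :* q) :+ (P :* (q :* q) :+ P :* (q :* q)) :+ k :* q
                   := (con 2 :* P :+ k) :* (q :* q) :+ (k :* q :+ ℓ :* (k :* q))) refl P k q ℓ ⟩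
    (2 * P + k) * (q * q) + suc ℓ * (k * q)
      ≡⟨ cong (λ x → x * (q * q) + suc ℓ * (k * q)) 2P+k≡k² ⟩
    k * k * (q * q) + suc ℓ * (k * q)
      ≡⟨ cong (_+ suc ℓ * (k * q)) (solve 2 (λ k q → k :* k :* (q :* q) := (k :* q) :* (k :* q)) refl k q) ⟩
    (k * q) * (k * q) + suc ℓ * (k * q) ∎

module _ {k n : ℕ} where

  dominated-cross : ∀ ℓ (f : Fin (k ^ suc ℓ) → Fin n) → Injective _≡_ _≡_ f → Dominated k (suc ℓ) f →
                    ∀ d e → d Fin.< e → 2 * cross (f ∘ combine d) (f ∘ combine e) + k ^ ℓ ≤ k ^ ℓ * k ^ ℓ
  dominated-cross ℓ f f-inj dom d e d<e =
    cross-≤ (f ∘ combine d) (f ∘ combine e) (combine-injective-block k (k ^ ℓ) f f-inj e)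
      (λ t → subst₂ _≤_ (blockSum-[i] ℓ (below t) e) (blockSum-[i] ℓ (below t) d) (dom [] d<e t))
    where below = λ t p → 𝟙 (f p Fin.≤? t)

  alternating-cross : ∀ ℓ (f : Fin (k ^ suc ℓ) → Fin n) → Injective _≡_ _≡_ f → Alternating k (suc ℓ) f →
                      ∀ d e → d Fin.< e → k ^ ℓ * k ^ ℓ ≤ 2 * cross (f ∘ combine d) (f ∘ combine e) + k ^ ℓ
  alternating-cross ℓ f f-inj alt d e d<e =
    cross-≥ (f ∘ combine d) (f ∘ combine e) (combine-injective-block k (k ^ ℓ) f f-inj e)
      (λ r s eq → Fin.<⇒≢ d<e (Fin.combine-injectiveˡ d r e s (f-inj eq)))
      (λ t → subst₂ _≤_ (blockSum-[i] ℓ (below t) d) (cong suc (blockSum-[i] ℓ (below t) e)) (alt [] d e t))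
    where below = λ t p → 𝟙 (f p Fin.<? t)

  dominated-inversionCount : ∀ ℓ (f : Fin (k ^ ℓ) → Fin n) → Injective _≡_ _≡_ f → Dominated k ℓ f →
    4 * inversionCount f + (ℓ * k ^ suc ℓ + k ^ ℓ) ≤ k ^ ℓ * k ^ ℓ + ℓ * k ^ ℓ
  -- A single leaf: both sides compute to 1.
  dominated-inversionCount zero    f f-inj dom = ≤-refl
  dominated-inversionCount (suc ℓ) f f-inj dom =
    inversionCount-step _≤_ ≤-refl +-mono-≤ {k} {k ^ ℓ} ℓ f
      (λ d → dominated-inversionCount ℓ (f ∘ combine d) (combine-injective-block k (k ^ ℓ) f f-inj d) (Dominated-block ℓ f dom d))
      (dominated-cross ℓ f f-inj dom)

  alternating-inversionCount : ∀ ℓ (f : Fin (k ^ ℓ) → Fin n) → Injective _≡_ _≡_ f → Dominated k ℓ f → Alternating k ℓ f →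
    4 * inversionCount f + (ℓ * k ^ suc ℓ + k ^ ℓ) ≡ k ^ ℓ * k ^ ℓ + ℓ * k ^ ℓ
  alternating-inversionCount zero    f f-inj dom alt = refl
  alternating-inversionCount (suc ℓ) f f-inj dom alt =
    inversionCount-step _≡_ refl (cong₂ _+_) {k} {k ^ ℓ} ℓ f
      (λ d → alternating-inversionCount ℓ (f ∘ combine d) (combine-injective-block k (k ^ ℓ) f f-inj d)
               (Dominated-block ℓ f dom d) (Alternating-block ℓ f alt d))
      (λ d e d<e → ≤-antisym (dominated-cross ℓ f f-inj dom d e d<e) (alternating-cross ℓ f f-inj alt d e d<e))

-- Reachable and stable configurations

injective⇒permutation : ∀ {n} (f : Fin n → Fin n) → Injective _≡_ _≡_ f → Σ[ π ∈ Permutation′ n ] (∀ i → π ⟨$⟩ʳ i ≡ f i)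
injective⇒permutation {zero}  f f-inj = Perm.id , λ ()
injective⇒permutation {suc n} f f-inj =
  Perm.permutation f (proj₁ ∘ surj) (proj₂ ∘ surj) (λ i → f-inj (proj₂ (surj (f i)))) , λ _ → refl
  where
  surj : ∀ y → ∃ λ x → f x ≡ y
  surj y with Fin.any? (λ x → f x ≟ y)
  ... | yes x,fx≡y = x,fx≡y
  -- Punching the missed value y out of the codomain would leave an injection from `Fin (suc n)` to
  -- `Fin n`.
  ... | no ∄x      = contradiction (Fin.injective⇒≤ (λ eq → f-inj (Fin.punchOut-injective (y≢f _) (y≢f _) eq))) 1+n≰n
    where
    y≢f : ∀ x → y ≢ f x
    y≢f x y≡fx = ∄x (x , sym y≡fx)

module _ {k n : ℕ} where

  -- With g constantly 1 this counts chips; with g the indicator of the labels ≤ t it is the N(t) of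
  -- the overview. An invariant over all suitable g covers both.
  weightBelow : Config k n → (Fin n → ℕ) → Vertex k → ℕ
  weightBelow c g v = ∑[ x < n ] (g x * inSubtree v (c x))

  chipCount : Config k n → Vertex k → ℕ
  chipCount c v = ∑[ x < n ] 𝟙 (c x ≟ᵥ v)

  length-chipsAt : ∀ c v → length (chipsAt c v) ≡ chipCount c v
  length-chipsAt c v = length-filter-tabulate (λ x → c x ≟ᵥ v) id

  weightBelow-children : ∀ c v → weightBelow c (λ _ → 1) v ≡ chipCount c v + ∑[ i < k ] weightBelow c (λ _ → 1) (v ∷ʳ i)
  weightBelow-children c v = begin
    ∑[ x < n ] (1 * inSubtree v (c x))
      ≡⟨ sum-cong-≗ {n} (λ x → trans (*-identityˡ _) (inSubtree-children v (c x))) ⟩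
    ∑[ x < n ] (𝟙 (c x ≟ᵥ v) + ∑[ i < k ] inSubtree (v ∷ʳ i) (c x))
      ≡⟨ ∑-distrib-+ {n} _ _ ⟩
    chipCount c v + ∑[ x < n ] ∑[ i < k ] inSubtree (v ∷ʳ i) (c x)
      ≡⟨ cong (chipCount c v +_) (∑-comm {n} {k} _) ⟩
    chipCount c v + ∑[ i < k ] ∑[ x < n ] inSubtree (v ∷ʳ i) (c x)
      ≡⟨ cong (chipCount c v +_) (sum-cong-≗ {k} (λ i → sum-cong-≗ {n} (λ x → sym (*-identityˡ _)))) ⟩
    chipCount c v + ∑[ i < k ] weightBelow c (λ _ → 1) (v ∷ʳ i) ∎
    where open ≡-Reasoning

  Increasing : (Fin k → Fin n) → Set
  Increasing a = ∀ {i j} → i Fin.< j → a i Fin.< a j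

  increasing⇒injective : ∀ {a} → Increasing a → Injective _≡_ _≡_ a
  increasing⇒injective a↑ {i} {j} eq with Fin.<-cmp i j
  ... | tri< i<j _ _ = contradiction eq (Fin.<⇒≢ (a↑ i<j))
  ... | tri≈ _ i≡j _ = i≡j
  ... | tri> _ _ j<i = contradiction (sym eq) (Fin.<⇒≢ (a↑ j<i))

  module _ {c c′ : Config k n} (fires : Fires c c′) where
    open Fires fires

    -- The only edge into the subtree of v ∷ʳ i comes from v. A firing elsewhere moves each of its
    -- chips within the subtree or outside it, and a firing at v sends into it just its i-th chip.
    inSubtree-fires : ∀ v i x →
      inSubtree (v ∷ʳ i) (c′ x) ≡ inSubtree (v ∷ʳ i) (c x) + 𝟙 (vertex ≟ᵥ v) * 𝟙 (x ≟ chips i)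
    inSubtree-fires v i x with Fin.any? (λ m → chips m ≟ x)
    ... | yes (m , refl) = begin
      inSubtree (v ∷ʳ i) (c′ (chips m))
        ≡⟨ cong (inSubtree (v ∷ʳ i)) (sent m) ⟩
      inSubtree (v ∷ʳ i) (vertex ∷ʳ m)
        ≡⟨ inSubtree-∷ʳ v i vertex m ⟩
      inSubtree (v ∷ʳ i) vertex + 𝟙 (vertex ≟ᵥ v) * 𝟙 (m ≟ i)
        ≡⟨ cong₂ (λ w b → inSubtree (v ∷ʳ i) w + 𝟙 (vertex ≟ᵥ v) * b) (sym (present m))
             (𝟙-cong (m ≟ i) (chips m ≟ chips i) (cong chips) (increasing⇒injective increasing)) ⟩
      inSubtree (v ∷ʳ i) (c (chips m)) + 𝟙 (vertex ≟ᵥ v) * 𝟙 (chips m ≟ chips i) ∎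
      where open ≡-Reasoning
    ... | no x∉chips = begin
      inSubtree (v ∷ʳ i) (c′ x)      ≡⟨ cong (inSubtree (v ∷ʳ i)) (unmoved x (λ m eq → x∉chips (m , eq))) ⟩
      inSubtree (v ∷ʳ i) (c x)       ≡⟨ +-identityʳ _ ⟨
      inSubtree (v ∷ʳ i) (c x) + 0   ≡⟨ cong (inSubtree (v ∷ʳ i) (c x) +_) (*-zeroʳ (𝟙 (vertex ≟ᵥ v))) ⟨
      inSubtree (v ∷ʳ i) (c x) + 𝟙 (vertex ≟ᵥ v) * 0
        ≡⟨ cong (λ b → inSubtree (v ∷ʳ i) (c x) + 𝟙 (vertex ≟ᵥ v) * b) (𝟙-no (x ≟ chips i) (λ eq → x∉chips (i , sym eq))) ⟨
      inSubtree (v ∷ʳ i) (c x) + 𝟙 (vertex ≟ᵥ v) * 𝟙 (x ≟ chips i) ∎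
      where open ≡-Reasoning

    weightBelow-fires : ∀ g v i → weightBelow c′ g (v ∷ʳ i) ≡ weightBelow c g (v ∷ʳ i) + 𝟙 (vertex ≟ᵥ v) * g (chips i)
    weightBelow-fires g v i = begin
      ∑[ x < n ] (g x * inSubtree (v ∷ʳ i) (c′ x))
        ≡⟨ sum-cong-≗ {n} (λ x → trans (cong (g x *_) (inSubtree-fires v i x))
             (solve 4 (λ g s b d → g :* (s :+ b :* d) := g :* s :+ b :* (d :* g)) refl
               (g x) (inSubtree (v ∷ʳ i) (c x)) (𝟙 (vertex ≟ᵥ v)) (𝟙 (x ≟ chips i)))) ⟩
      ∑[ x < n ] (g x * inSubtree (v ∷ʳ i) (c x) + 𝟙 (vertex ≟ᵥ v) * (𝟙 (x ≟ chips i) * g x))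
        ≡⟨ ∑-distrib-+ {n} _ _ ⟩
      weightBelow c g (v ∷ʳ i) + ∑[ x < n ] (𝟙 (vertex ≟ᵥ v) * (𝟙 (x ≟ chips i) * g x))
        ≡⟨ cong (weightBelow c g (v ∷ʳ i) +_) 
             (trans (sym (*-distribˡ-sum {n} (𝟙 (vertex ≟ᵥ v)) _)) (cong (𝟙 (vertex ≟ᵥ v) *_) (sum-𝟙-≟ (chips i) g))) ⟩
      weightBelow c g (v ∷ʳ i) + 𝟙 (vertex ≟ᵥ v) * g (chips i) ∎
      where
      open ≡-Reasoning
      open +-*-Solver

  -- A firing at v adds g (aᵢ) to the i-th child for its chips a₁ < … < aₖ, and
  -- leaves the children of every other vertex balanced as they were.
  Balanced : Config k n → Set
  Balanced c = ∀ v i j (g : Fin n → ℕ) → (∀ a → Increasing a → g (a j) ≤ g (a i)) →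
               weightBelow c g (v ∷ʳ j) ≤ weightBelow c g (v ∷ʳ i)

  Balanced-fires : ∀ {c c′} → Fires c c′ → Balanced c → Balanced c′
  Balanced-fires {c} {c′} fires bal v i j g g-dec = begin
    weightBelow c′ g (v ∷ʳ j)
      ≡⟨ weightBelow-fires fires g v j ⟩
    weightBelow c g (v ∷ʳ j) + 𝟙 (vertex ≟ᵥ v) * g (chips j)
      ≤⟨ +-mono-≤ (bal v i j g g-dec) (*-monoʳ-≤ (𝟙 (vertex ≟ᵥ v)) (g-dec chips increasing)) ⟩
    weightBelow c g (v ∷ʳ i) + 𝟙 (vertex ≟ᵥ v) * g (chips i)
      ≡⟨ weightBelow-fires fires g v i ⟨
    weightBelow c′ g (v ∷ʳ i) ∎
    where
    open Fires fires
    open ≤-Reasoning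

  Balanced-initial : Balanced initial
  Balanced-initial v i j g _ = ≤-trans
    (≤-reflexive (sum-zero {n} (λ x → trans (cong (g x *_) (inSubtree-∷ʳ-[] v j)) (*-zeroʳ (g x))))) z≤n

  reachable⇒balanced : ∀ {c} → Reachable c → Balanced c
  reachable⇒balanced = go Balanced-initial
    where
    go : ∀ {c c′} → Balanced c → Star Fires c c′ → Balanced c′
    go bal ε        = bal
    go bal (f ◅ fs) = go (Balanced-fires f bal) fs

quotient-unique : ∀ {k a q} Q → a < k → k * Q ≡ a + k * q → a ≡ 0 × q ≡ Q
quotient-unique {k@(suc _)} {a} {q} Q a<k eq = a≡0 , *-cancelˡ-≡ q Q k (sym (trans eq (cong (_+ k * q) a≡0)))
  where
  a≡0 : a ≡ 0
  a≡0 = begin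
    a                 ≡⟨ m<n⇒m%n≡m a<k ⟨
    a % k             ≡⟨ [m+kn]%n≡m%n a q k ⟨
    (a + q * k) % k   ≡⟨ cong (λ x → (a + x) % k) (*-comm q k) ⟩
    (a + k * q) % k   ≡⟨ cong (_% k) eq ⟨
    (k * Q) % k       ≡⟨ cong (_% k) (*-comm k Q) ⟩
    (Q * k) % k       ≡⟨ m*n%n≡0 Q k ⟩
    0                 ∎
    where open ≡-Reasoning

module _ {k ℓ : ℕ} (2≤k : 2 ≤ k) {c : Config k (k ^ ℓ)} (reach : Reachable c) (stable : Stable c) where

  private
    #below : Vertex k → ℕ
    #below = weightBelow c (λ _ → 1)

    chipCount<k : ∀ v → chipCount c v < k
    chipCount<k v = subst (_< k) (length-chipsAt c v) (stable v)

    #below-child : ∀ v i → #below v ≡ chipCount c v + k * #below (v ∷ʳ i)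
    #below-child v i = trans (weightBelow-children c v) (cong (chipCount c v +_)
      (trans (sum-cong-≗ {k} (λ j → ≤-antisym (equal i j) (equal j i))) (sum-const k _)))
      where
      equal : ∀ i j → #below (v ∷ʳ j) ≤ #below (v ∷ʳ i)
      equal i j = reachable⇒balanced reach v i j (λ _ → 1) (λ _ _ → ≤-refl)

    -- If k · k^h chips lie at or below v, the children's subtrees share equally all but the fewer
    -- than k chips resting on v. Divisibility by k leaves none on v, hence k^h below each child.
    #below-descend : ∀ v u → #below v ≡ k ^ length u → #below (v ++ u) ≡ 1
    #below-descend v []      eq = trans (cong #below (++-identityʳ v)) eq
    #below-descend v (i ∷ u) eq = trans (cong #below (sym (∷ʳ-++ v i u)))
      (#below-descend (v ∷ʳ i) u (proj₂ (quotient-unique {k} (k ^ length u) (chipCount<k v) (trans (sym eq) (#below-child v i)))))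

    #below-leaf : ∀ p → #below (vertexOnLayer k ℓ p) ≡ 1
    #below-leaf p = #below-descend [] (vertexOnLayer k ℓ p)
      (trans (sum-const (k ^ ℓ) 1) (trans (*-identityʳ (k ^ ℓ)) (cong (k ^_) (sym (length-vertexOnLayer k ℓ p)))))

    -- One chip lies at or below the leaf. If none rested on it, the equal shares of the children's
    -- subtrees would make k divide 1.
    chipCount-leaf : ∀ p → chipCount c (vertexOnLayer k ℓ p) ≢ 0
    chipCount-leaf p count≡0 = <⇒≱ 2≤k (∣⇒≤ (divides (#below (v ∷ʳ i₀)) (begin
      1                                    ≡⟨ #below-leaf p ⟨
      #below v                             ≡⟨ #below-child v i₀ ⟩
      chipCount c v + k * #below (v ∷ʳ i₀) ≡⟨ cong (_+ k * #below (v ∷ʳ i₀)) count≡0 ⟩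
      k * #below (v ∷ʳ i₀)                 ≡⟨ *-comm k _ ⟩
      #below (v ∷ʳ i₀) * k                 ∎)))
      where
      open ≡-Reasoning
      v  = vertexOnLayer k ℓ p
      i₀ = Fin.fromℕ< (≤-trans (s≤s z≤n) 2≤k)

    leafChip : ∀ p → ∃ λ x → c x ≡ vertexOnLayer k ℓ p
    leafChip p = sum≢0⇒∃ (λ x → c x ≟ᵥ vertexOnLayer k ℓ p) (chipCount-leaf p)

  -- Choosing a chip on each leaf is injective, since a chip sits on one vertex only. Leaves and
  -- chips are equally many, so the choice is a permutation and no chip is left for another vertex.
  stable⇒readsAs : Σ[ π ∈ Permutation′ (k ^ ℓ) ] ReadsAs k ℓ c π
  stable⇒readsAs with injective⇒permutation (proj₁ ∘ leafChip) (λ {p} {p′} eq →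
    vertexOnLayer-injective k ℓ (trans (sym (proj₂ (leafChip p))) (trans (cong c eq) (proj₂ (leafChip p′)))))
  ... | π , π≗ = π , λ p → trans (cong c (π≗ p)) (proj₂ (leafChip p))

  module _ {π : Permutation′ (k ^ ℓ)} (reads : ReadsAs k ℓ c π) where

    blockSum≡weightBelow : ∀ g v → blockSum ℓ (g ∘ (π ⟨$⟩ʳ_)) v ≡ weightBelow c g v
    blockSum≡weightBelow g v = sym (trans (sum-permute {k ^ ℓ} {k ^ ℓ} _ π)
      (sum-cong-≗ {k ^ ℓ} (λ p → cong (λ w → g (π ⟨$⟩ʳ p) * inSubtree v w) (reads p))))

    readsAs⇒dominated : Dominated k ℓ (π ⟨$⟩ʳ_)
    readsAs⇒dominated v {i} {j} i<j t =
      subst₂ _≤_ (sym (blockSum≡weightBelow below (v ∷ʳ j))) (sym (blockSum≡weightBelow below (v ∷ʳ i)))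
        (reachable⇒balanced reach v i j below
          (λ a a↑ → 𝟙-mono (a j Fin.≤? t) (a i Fin.≤? t) (λ aj≤t → ≤-trans (<⇒≤ (a↑ i<j)) aj≤t)))
      where below = λ x → 𝟙 (x Fin.≤? t)

-- Base-k digits

-- Interlacing in summed form: the initial term of a costs at most 1, and every later term is paid
-- for by the preceding term of b.
∑-shift-≤ : ∀ N (a b : ℕ → ℕ) → (∀ y → a y ≤ 1) → (∀ y → a (suc y) ≤ b y) →
            ∑[ y < N ] a (toℕ y) ≤ suc (∑[ y < N ] b (toℕ y))
∑-shift-≤ zero    a b a≤1 a≤b = z≤n
∑-shift-≤ (suc N) a b a≤1 a≤b =
  +-mono-≤ (a≤1 0) (≤-trans (sum-mono-≤ {N} (λ y → a≤b (toℕ y))) (extend N b))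
  where
  extend : ∀ N (b : ℕ → ℕ) → ∑[ y < N ] b (toℕ y) ≤ ∑[ y < suc N ] b (toℕ y)
  extend zero    b = z≤n
  extend (suc N) b = +-monoʳ-≤ (b 0) (extend N (b ∘ suc))

∑-𝟙-< : ∀ N x → x ≤ N → ∑[ y < N ] 𝟙 (toℕ y ℕ.<? x) ≡ x
∑-𝟙-< N       zero    _         = sum-zero {N} (λ y → 𝟙-no (toℕ y ℕ.<? 0) λ ())
∑-𝟙-< (suc N) (suc x) (s≤s x≤N) = cong suc (trans
  (sum-cong-≗ {N} (λ y → 𝟙-cong (suc (toℕ y) ℕ.<? suc x) (toℕ y ℕ.<? x) ℕ.s<s⁻¹ s≤s)) (∑-𝟙-< N x x≤N))

sum-𝟙≤1 : ∀ {n p} {P : Fin n → Set p} (P? : Decidable P) → (∀ {x y} → P x → P y → x ≡ y) → ∑[ x < n ] 𝟙 (P? x) ≤ 1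
sum-𝟙≤1 {n} P? unique with Fin.any? P?
... | no ∄x        = ≤-trans (≤-reflexive (sum-zero {n} (λ x → 𝟙-no (P? x) (λ px → ∄x (x , px))))) z≤n
... | yes (a , pa) = ≤-trans
  (sum-mono-≤ {n} (λ x → ≤-trans (𝟙-mono (P? x) (x ≟ a) (λ px → unique px pa)) (≤-reflexive (sym (*-identityʳ _)))))
  (≤-reflexive (sum-𝟙-≟ a (λ _ → 1)))

module _ (k : ℕ) .{{_ : NonZero k}} where

  -- The lowest digit comes first, opposite to `vertexOnLayer`. Read as a path, `digits ℓ x` with x
  -- < k^ℓ therefore leads to the leaf whose position is the digit reversal of x.
  digits : ℕ → ℕ → Vertex k
  digits zero    x = []
  digits (suc m) x = (x mod k) ∷ digits m (x / k)

  -- This is ⌊x / k^m⌋, written as repeated division so that it unfolds in step with `digits`.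
  dropDigits : ℕ → ℕ → ℕ
  dropDigits zero    x = x
  dropDigits (suc m) x = dropDigits m (x / k)

  digits-∷ʳ : ∀ m x → digits (suc m) x ≡ digits m x ∷ʳ (dropDigits m x mod k)
  digits-∷ʳ zero    x = refl
  digits-∷ʳ (suc m) x = cong ((x mod k) ∷_) (digits-∷ʳ m (x / k))

  [k*y+s]/k : ∀ y s → (k * y + s) / k ≡ y + s / k
  [k*y+s]/k y s = trans (+-distrib-/-∣ˡ s (divides y (*-comm k y)))
                        (cong (_+ s / k) (trans (cong (_/ k) (*-comm k y)) (m*n/n≡m y k)))

  [k*y+s]%k : ∀ y s → (k * y + s) % k ≡ s % k
  [k*y+s]%k y s = trans (cong (_% k) (trans (+-comm (k * y) s) (cong (s +_) (*-comm k y)))) ([m+kn]%n≡m%n s y k)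

  [k*y+s]mod-k : ∀ y s → (k * y + s) mod k ≡ s mod k
  [k*y+s]mod-k y s = Fin.fromℕ<-cong _ _ ([k*y+s]%k y s) _ _

  toℕ-mod : ∀ x → toℕ (x mod k) ≡ x % k
  toℕ-mod x = Fin.toℕ-fromℕ< _

  mod-toℕ : ∀ (i : Fin k) → toℕ i mod k ≡ i
  mod-toℕ i = toℕ-injective (trans (toℕ-mod (toℕ i)) (m<n⇒m%n≡m (toℕ<n i)))

  m≡k*[m/k]+m-mod-k : ∀ x → x ≡ k * (x / k) + toℕ (x mod k)
  m≡k*[m/k]+m-mod-k x = trans (m≡m%n+[m/n]*n x k)
    (trans (+-comm (x % k) _) (cong₂ _+_ (*-comm (x / k) k) (sym (toℕ-mod x))))

  digits-suc : ∀ m y (s : Fin k) → digits (suc m) (k * y + toℕ s) ≡ s ∷ digits m y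
  digits-suc m y s = cong₂ _∷_ (trans ([k*y+s]mod-k y (toℕ s)) (mod-toℕ s))
    (cong (digits m) (trans ([k*y+s]/k y (toℕ s)) (trans (cong (y +_) (m<n⇒m/n≡0 (toℕ<n s))) (+-identityʳ y))))

  /k-< : ∀ {x N} → x < k * N → x / k < N
  /k-< {x} {N} x<kN = m<n*o⇒m/o<n (subst (x <_) (*-comm k N) x<kN)

  digits-injective : ∀ ℓ {x y} → x < k ^ ℓ → y < k ^ ℓ → digits ℓ x ≡ digits ℓ y → x ≡ y
  digits-injective zero    (s≤s z≤n) (s≤s z≤n) _ = refl
  digits-injective (suc ℓ) {x} {y} x< y< eq = begin
    x
      ≡⟨ m≡k*[m/k]+m-mod-k x ⟩
    k * (x / k) + toℕ (x mod k)
      ≡⟨ cong₂ (λ q r → k * q + toℕ r)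
           (digits-injective ℓ (/k-< x<) (/k-< y<) (proj₂ (∷-injective eq))) (proj₁ (∷-injective eq)) ⟩
    k * (y / k) + toℕ (y mod k)
      ≡⟨ m≡k*[m/k]+m-mod-k y ⟨
    y ∎
    where open ≡-Reasoning

  ∑-by-lowest-digit : ∀ N (h : ℕ → ℕ) → ∑[ x < k * N ] h (toℕ x) ≡ ∑[ y < N ] ∑[ s < k ] h (k * toℕ y + toℕ s)
  ∑-by-lowest-digit N h = begin
    ∑[ x < k * N ] h (toℕ x)
      ≡⟨ cong (λ n → ∑[ x < n ] h (toℕ x)) (*-comm k N) ⟩
    ∑[ x < N * k ] h (toℕ x)
      ≡⟨ sum-combine N _ ⟩
    ∑[ y < N ] ∑[ s < k ] h (toℕ (combine y s))
      ≡⟨ sum-cong-≗ {N} (λ y → sum-cong-≗ {k} (λ s → cong h (Fin.toℕ-combine y s))) ⟩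
    ∑[ y < N ] ∑[ s < k ] h (k * toℕ y + toℕ s) ∎
    where open ≡-Reasoning

  -- The y that share the m lowest digits of x form a residue class modulo k^m, with ⌊x / k^m⌋
  -- members below x. The induction strips the common lowest digit, which turns y < x into y / k < x
  -- / k.
  digits-rank : ∀ {ℓ m} x → m ≤ ℓ → x < k ^ ℓ →
    ∑[ y < k ^ ℓ ] (𝟙 (digits m (toℕ y) ≟ᵥ digits m x) * 𝟙 (toℕ y ℕ.<? x)) ≡ dropDigits m x
  digits-rank {ℓ} {zero} x _ x< = trans (sum-cong-≗ {k ^ ℓ} (λ y → *-identityˡ _)) (∑-𝟙-< (k ^ ℓ) x (<⇒≤ x<))
  digits-rank {suc ℓ} {suc m} x (s≤s m≤ℓ) x< = begin
    ∑[ y < k ^ suc ℓ ] (𝟙 (digits (suc m) (toℕ y) ≟ᵥ digits (suc m) x) * 𝟙 (toℕ y ℕ.<? x))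
      ≡⟨ ∑-by-lowest-digit (k ^ ℓ) (λ y → 𝟙 (digits (suc m) y ≟ᵥ digits (suc m) x) * 𝟙 (y ℕ.<? x)) ⟩
    ∑[ y < k ^ ℓ ] ∑[ s < k ] (𝟙 (digits (suc m) (k * toℕ y + toℕ s) ≟ᵥ digits (suc m) x) * 𝟙 (k * toℕ y + toℕ s ℕ.<? x))
      ≡⟨ sum-cong-≗ {k ^ ℓ} (λ y → trans (sum-cong-≗ {k} (term (toℕ y))) (sum-𝟙-≟ (x mod k) _)) ⟩
    ∑[ y < k ^ ℓ ] (𝟙 (digits m (toℕ y) ≟ᵥ digits m (x / k)) * 𝟙 (k * toℕ y + toℕ (x mod k) ℕ.<? x))
      ≡⟨ sum-cong-≗ {k ^ ℓ} (λ y → cong (𝟙 (digits m (toℕ y) ≟ᵥ digits m (x / k)) *_)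
           (𝟙-cong (k * toℕ y + toℕ (x mod k) ℕ.<? x) (toℕ y ℕ.<? x / k) (to (toℕ y)) (from (toℕ y)))) ⟩
    ∑[ y < k ^ ℓ ] (𝟙 (digits m (toℕ y) ≟ᵥ digits m (x / k)) * 𝟙 (toℕ y ℕ.<? x / k))
      ≡⟨ digits-rank (x / k) m≤ℓ (/k-< x<) ⟩
    dropDigits m (x / k) ∎
    where
    open ≡-Reasoning
    term : ∀ y s → 𝟙 (digits (suc m) (k * y + toℕ s) ≟ᵥ digits (suc m) x) * 𝟙 (k * y + toℕ s ℕ.<? x)
                   ≡ 𝟙 (s ≟ (x mod k)) * (𝟙 (digits m y ≟ᵥ digits m (x / k)) * 𝟙 (k * y + toℕ s ℕ.<? x))
    term y s = begin
      𝟙 (digits (suc m) (k * y + toℕ s) ≟ᵥ digits (suc m) x) * below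
        ≡⟨ cong (λ w → 𝟙 (w ≟ᵥ digits (suc m) x) * below) (digits-suc m y s) ⟩
      𝟙 ((s ∷ digits m y) ≟ᵥ digits (suc m) x) * below
        ≡⟨ cong (_* below) (𝟙-∷-≟ᵥ (x mod k) s (digits m (x / k)) (digits m y)) ⟩
      𝟙 (s ≟ (x mod k)) * 𝟙 (digits m y ≟ᵥ digits m (x / k)) * below
        ≡⟨ *-assoc (𝟙 (s ≟ (x mod k))) _ _ ⟩
      𝟙 (s ≟ (x mod k)) * (𝟙 (digits m y ≟ᵥ digits m (x / k)) * below) ∎
      where below = 𝟙 (k * y + toℕ s ℕ.<? x)
    to : ∀ y → k * y + toℕ (x mod k) < x → y < x / k
    to y lt = *-cancelˡ-< k y (x / k) (+-cancelʳ-< (toℕ (x mod k)) _ _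
      (subst (k * y + toℕ (x mod k) <_) (m≡k*[m/k]+m-mod-k x) lt))
    from : ∀ y → y < x / k → k * y + toℕ (x mod k) < x
    from y lt = subst (k * y + toℕ (x mod k) <_) (sym (m≡k*[m/k]+m-mod-k x)) (+-monoˡ-< (toℕ (x mod k)) (*-monoʳ-< k lt))

  -- The threshold is tested on M y + r because reading a digit a of the vertex
  -- turns (M , r) into (M k , M a + r) and leaves t alone.
  digitCount : (ℓ M r t : ℕ) → Vertex k → ℕ
  digitCount ℓ M r t v = ∑[ y < k ^ ℓ ] (𝟙 (M * toℕ y + r ℕ.<? t) * inSubtree v (digits ℓ (toℕ y)))

  digitCount-∷ : ∀ ℓ M r t a v → digitCount (suc ℓ) M r t (a ∷ v) ≡ digitCount ℓ (M * k) (M * toℕ a + r) t v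
  digitCount-∷ ℓ M r t a v = begin
    ∑[ y < k ^ suc ℓ ] (𝟙 (M * toℕ y + r ℕ.<? t) * inSubtree (a ∷ v) (digits (suc ℓ) (toℕ y)))
      ≡⟨ ∑-by-lowest-digit (k ^ ℓ) (λ y → 𝟙 (M * y + r ℕ.<? t) * inSubtree (a ∷ v) (digits (suc ℓ) y)) ⟩
    ∑[ y < k ^ ℓ ] ∑[ s < k ] (𝟙 (M * (k * toℕ y + toℕ s) + r ℕ.<? t) * inSubtree (a ∷ v) (digits (suc ℓ) (k * toℕ y + toℕ s)))
      ≡⟨ sum-cong-≗ {k ^ ℓ} (λ y → trans (sum-cong-≗ {k} (term (toℕ y))) (sum-𝟙-≟ a _)) ⟩
    ∑[ y < k ^ ℓ ] (𝟙 (M * (k * toℕ y + toℕ a) + r ℕ.<? t) * inSubtree v (digits ℓ (toℕ y)))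
      ≡⟨ sum-cong-≗ {k ^ ℓ} (λ y → cong (λ z → 𝟙 (z ℕ.<? t) * inSubtree v (digits ℓ (toℕ y)))
           (solve 5 (λ M k y a r → M :* (k :* y :+ a) :+ r := M :* k :* y :+ (M :* a :+ r)) refl M k (toℕ y) (toℕ a) r)) ⟩
    digitCount ℓ (M * k) (M * toℕ a + r) t v ∎
    where
    open ≡-Reasoning
    open +-*-Solver
    term : ∀ y s → 𝟙 (M * (k * y + toℕ s) + r ℕ.<? t) * inSubtree (a ∷ v) (digits (suc ℓ) (k * y + toℕ s))
                   ≡ 𝟙 (s ≟ a) * (𝟙 (M * (k * y + toℕ s) + r ℕ.<? t) * inSubtree v (digits ℓ y))
    term y s = trans (cong (λ w → 𝟙 (M * (k * y + toℕ s) + r ℕ.<? t) * inSubtree (a ∷ v) w) (digits-suc ℓ y s))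
      (solve 3 (λ x y z → x :* (y :* z) := y :* (x :* z)) refl (𝟙 (M * (k * y + toℕ s) + r ℕ.<? t)) (𝟙 (s ≟ a)) _)

  -- The digits already read restrict the labels to M y + r with r < M, a condition that reading one
  -- more digit preserves. At the last digit, i and j give progressions with the same modulus M k
  -- and offsets below it, so term y + 1 of one exceeds term y of the other, and `∑-shift-≤`
  -- applies.
  digitCount-alternates : ∀ ℓ M r t → r < M → ∀ v i j → digitCount ℓ M r t (v ∷ʳ i) ≤ suc (digitCount ℓ M r t (v ∷ʳ j))
  digitCount-alternates zero M r t r<M v i j rewrite inSubtree-∷ʳ-[] v i =
    ≤-trans (≤-reflexive (trans (+-identityʳ _) (*-zeroʳ (𝟙 (M * 0 + r ℕ.<? t))))) z≤n
  digitCount-alternates (suc ℓ) M r t r<M v i j = go v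
    where
    offset< : ∀ (a : Fin k) → M * toℕ a + r < M * k
    offset< a = begin-strict
      M * toℕ a + r     <⟨ +-monoʳ-< (M * toℕ a) r<M ⟩
      M * toℕ a + M     ≡⟨ trans (+-comm _ M) (sym (*-suc M (toℕ a))) ⟩
      M * suc (toℕ a)   ≤⟨ *-monoʳ-≤ M (toℕ<n a) ⟩
      M * k             ∎
      where open ≤-Reasoning
    count : Fin k → ℕ → ℕ
    count a y = 𝟙 (M * k * y + (M * toℕ a + r) ℕ.<? t) * 1
    next : ∀ y → M * k * suc y + (M * toℕ i + r) < t → M * k * y + (M * toℕ j + r) < t
    next y = ≤-<-trans (begin
      M * k * y + (M * toℕ j + r)       ≤⟨ +-monoʳ-≤ (M * k * y) (<⇒≤ (offset< j)) ⟩
      M * k * y + M * k                 ≡⟨ trans (+-comm _ (M * k)) (sym (*-suc (M * k) y)) ⟩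
      M * k * suc y                     ≤⟨ m≤m+n _ _ ⟩
      M * k * suc y + (M * toℕ i + r)   ∎)
      where open ≤-Reasoning
    go : ∀ v → digitCount (suc ℓ) M r t (v ∷ʳ i) ≤ suc (digitCount (suc ℓ) M r t (v ∷ʳ j))
    go []      = subst₂ _≤_ (sym (digitCount-∷ ℓ M r t i [])) (cong suc (sym (digitCount-∷ ℓ M r t j [])))
      (∑-shift-≤ (k ^ ℓ) (count i) (count j) (λ y → ≤-trans (≤-reflexive (*-identityʳ _)) (𝟙≤1 (_ ℕ.<? t)))
        (λ y → *-monoˡ-≤ 1 (𝟙-mono (_ ℕ.<? t) (_ ℕ.<? t) (next y))))
    go (a ∷ v) = subst₂ _≤_ (sym (digitCount-∷ ℓ M r t a (v ∷ʳ i))) (cong suc (sym (digitCount-∷ ℓ M r t a (v ∷ʳ j))))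
      (digitCount-alternates ℓ (M * k) (M * toℕ a + r) t (offset< a) v i j)

-- The consecutive strategy

Fires-cong : ∀ {k n} {c c₁ d d₁ : Config k n} → c ≗ c₁ → d ≗ d₁ → Fires c d → Fires c₁ d₁
Fires-cong c≗ d≗ f = record
  { vertex     = vertex
  ; chips      = chips
  ; increasing = increasing
  ; present    = λ i → trans (sym (c≗ _)) (present i)
  ; sent       = λ i → trans (sym (d≗ _)) (sent i)
  ; unmoved    = λ x x∉ → trans (sym (d≗ x)) (trans (unmoved x x∉) (c≗ x))
  }
  where open Fires f

-- There are T + 1 > 0 tuples because, without function extensionality, only an
-- actual firing can end in d itself rather than in a pointwise equal configuration.
fireTuples : ∀ {k n T} {c d : Config k n} (tuple : Fin n → Fin (suc T)) (slot : Fin n → Fin k)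
             (chip : Fin (suc T) → Fin k → Fin n) (at : Fin (suc T) → Vertex k) →
             (∀ s i → tuple (chip s i) ≡ s) → (∀ x → chip (tuple x) (slot x) ≡ x) →
             (∀ s → Increasing (chip s)) →
             (∀ s i → c (chip s i) ≡ at s) → (∀ s i → d (chip s i) ≡ at s ∷ʳ i) → Star Fires c d
fireTuples {k} {n} {T} {c} {d} tuple slot chip at tuple-chip chip-tuple chip-increasing c-chip d-chip =
  go 0 T refl (λ _ → refl)
  where
  -- Interpolates between c and d: the tuples numbered below s have moved and the others have not,
  -- so neighbouring stages differ by one firing.
  stage : ℕ → Config k n
  stage s x with toℕ (tuple x) ℕ.<? s
  ... | yes _ = d x
  ... | no _  = c x

  fired : ∀ {s} x → toℕ (tuple x) < s → stage s x ≡ d x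
  fired {s} x lt with toℕ (tuple x) ℕ.<? s
  ... | yes _ = refl
  ... | no ≮  = contradiction lt ≮

  unfired : ∀ {s} x → s ≤ toℕ (tuple x) → stage s x ≡ c x
  unfired {s} x s≤ with toℕ (tuple x) ℕ.<? s
  ... | yes lt = contradiction lt (≤⇒≯ s≤)
  ... | no _   = refl

  fire : ∀ s → Fires (stage (toℕ s)) (stage (suc (toℕ s)))
  fire s = record
    { vertex     = at s
    ; chips      = chip s
    ; increasing = chip-increasing s
    ; present    = λ i → trans (unfired (chip s i) (≤-reflexive (cong toℕ (sym (tuple-chip s i))))) (c-chip s i)
    ; sent       = λ i → trans (fired (chip s i) (s≤s (≤-reflexive (cong toℕ (tuple-chip s i))))) (d-chip s i)
    ; unmoved    = unmoved
    }
    where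
    unmoved : ∀ x → (∀ i → chip s i ≢ x) → stage (suc (toℕ s)) x ≡ stage (toℕ s) x
    unmoved x x∉ with Fin.<-cmp (tuple x) s
    ... | tri< τ<s _ _  = trans (fired x (m<n⇒m<1+n τ<s)) (sym (fired x τ<s))
    ... | tri≈ _ refl _ = contradiction (chip-tuple x) (x∉ (slot x))
    ... | tri> _ _ s<τ  = trans (unfired x s<τ) (sym (unfired x (<⇒≤ s<τ)))

  stage-last : stage (suc T) ≗ d
  stage-last x = fired x (toℕ<n (tuple x))

  fireℕ : ∀ s → s < suc T → Fires (stage s) (stage (suc s))
  fireℕ s s< = subst (λ m → Fires (stage m) (stage (suc m))) (Fin.toℕ-fromℕ< s<) (fire (Fin.fromℕ< s<))

  go : ∀ s j → s + j ≡ T → {c′ : Config k n} → stage s ≗ c′ → Star Fires c′ d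
  -- At j = 0 the firing of tuple T is still due; its target `stage (suc T)` is the one replaced by
  -- `d`.
  go s zero    eq c≗ = Fires-cong c≗ (subst (λ m → stage (suc m) ≗ d) s≡T stage-last) (fireℕ s (s≤s (≤-reflexive (sym s≡T)))) ◅ ε
    where
    s≡T : T ≡ s
    s≡T = trans (sym eq) (+-identityʳ s)
  go s (suc j) eq c≗ = Fires-cong c≗ (λ _ → refl) (fireℕ s (s≤s (m+n≤o⇒m≤o s (≤-reflexive eq))))
                       ◅ go (suc s) j (trans (sym (+-suc s j)) eq) (λ _ → refl)

module _ (k : ℕ) .{{_ : NonZero k}} where

  digits-low : ∀ m z r → digits k m (k ^ m * z + r) ≡ digits k m r
  digits-low zero    z r = refl
  digits-low (suc m) z r rewrite *-assoc k (k ^ m) z =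
    cong₂ _∷_ ([k*y+s]mod-k k (k ^ m * z) r) (trans (cong (digits k m) ([k*y+s]/k k (k ^ m * z) r)) (digits-low m z (r / k)))

  dropDigits-high : ∀ m z {r} → r < k ^ m → dropDigits k m (k ^ m * z + r) ≡ z
  dropDigits-high zero    z {zero} _ = trans (+-identityʳ (z + 0)) (+-identityʳ z)
  dropDigits-high zero    z {suc r} (s≤s ())
  dropDigits-high (suc m) z {r} r< rewrite *-assoc k (k ^ m) z =
    trans (cong (dropDigits k m) ([k*y+s]/k k (k ^ m * z) r)) (dropDigits-high m z (/k-< k r<))

  -- Write a chip as x = k^m (k q + i) + r with r < k^m. Then r determines the vertex, i the child,
  -- and q numbers the tuple on that vertex; h is the number of digits above i. The tuples, indexed
  -- by (q , r), partition the chips.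
  fireRound : ∀ m h {n} → n ≡ (k ^ h * k) * k ^ m → (c d : Config k n) →
              (∀ x → c x ≡ digits k m (toℕ x)) → (∀ x → d x ≡ digits k (suc m) (toℕ x)) → Star Fires c d
  -- `fireTuples` takes the number of tuples as a successor, hence the match on the product together
  -- with a proof that it is nonzero.
  fireRound m h refl c d c≗ d≗ with k ^ h * k ^ m in T≡ | m*n≢0 (k ^ h) (k ^ m) {{m^n≢0 k h}} {{m^n≢0 k m}}
  ... | suc T | _ = fireTuples tuple slot chip at tuple-chip chip-tuple chip-increasing c-chip d-chip
    where
    M = k ^ m
    H = k ^ h
    join : Fin H → Fin M → Fin (suc T)
    join q r = Fin.cast T≡ (combine q r)
    split : Fin (suc T) → Fin H × Fin M
    split s = Fin.remQuot {H} M (Fin.cast (sym T≡) s)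
    split-join : ∀ q r → split (join q r) ≡ (q , r)
    split-join q r = trans
      (cong (Fin.remQuot {H} M) (trans (Fin.cast-trans T≡ (sym T≡) (combine q r)) (Fin.cast-is-id refl _)))
      (Fin.remQuot-combine q r)
    join-split : ∀ s → join (proj₁ (split s)) (proj₂ (split s)) ≡ s
    join-split s = trans (cong (Fin.cast T≡) (Fin.combine-remQuot {H} M _))
                         (trans (Fin.cast-trans (sym T≡) T≡ s) (Fin.cast-is-id refl s))

    high : Fin (H * k * M) → Fin H × Fin k
    high x = Fin.remQuot {H} k (proj₁ (Fin.remQuot {H * k} M x))
    low : Fin (H * k * M) → Fin M
    low x = proj₂ (Fin.remQuot {H * k} M x)

    tuple : Fin (H * k * M) → Fin (suc T)
    tuple x = join (proj₁ (high x)) (low x)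
    slot : Fin (H * k * M) → Fin k
    slot x = proj₂ (high x)
    chip : Fin (suc T) → Fin k → Fin (H * k * M)
    chip s i = combine (combine (proj₁ (split s)) i) (proj₂ (split s))
    at : Fin (suc T) → Vertex k
    at s = digits k m (toℕ (proj₂ (split s)))

    remQuot-chip : ∀ s i → Fin.remQuot {H * k} M (chip s i) ≡ (combine (proj₁ (split s)) i , proj₂ (split s))
    remQuot-chip s i = Fin.remQuot-combine (combine (proj₁ (split s)) i) (proj₂ (split s))

    tuple-chip : ∀ s i → tuple (chip s i) ≡ s
    tuple-chip s i = trans (cong (λ (z , r) → join (proj₁ (Fin.remQuot {H} k z)) r) (remQuot-chip s i))
      (trans (cong (λ z → join (proj₁ z) (proj₂ (split s))) (Fin.remQuot-combine (proj₁ (split s)) i)) (join-split s))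

    chip-tuple : ∀ x → chip (tuple x) (slot x) ≡ x
    chip-tuple x = trans (cong (λ (q , r) → combine (combine q (slot x)) r) (split-join (proj₁ (high x)) (low x)))
      (trans (cong (λ z → combine z (low x)) (Fin.combine-remQuot {H} k (proj₁ (Fin.remQuot {H * k} M x))))
             (Fin.combine-remQuot {H * k} M x))

    chip-increasing : ∀ s → Increasing (chip s)
    chip-increasing s {i} {j} i<j = Fin.combine-monoˡ-< (proj₂ (split s)) (proj₂ (split s))
      (subst₂ _<_ (sym (Fin.toℕ-combine (proj₁ (split s)) i)) (sym (Fin.toℕ-combine (proj₁ (split s)) j))
              (+-monoʳ-< (k * toℕ (proj₁ (split s))) i<j))

    toℕ-chip : ∀ s i → toℕ (chip s i) ≡ M * toℕ (combine (proj₁ (split s)) i) + toℕ (proj₂ (split s))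
    toℕ-chip s i = Fin.toℕ-combine (combine (proj₁ (split s)) i) (proj₂ (split s))

    low-digits : ∀ s i → digits k m (toℕ (chip s i)) ≡ at s
    low-digits s i = trans (cong (digits k m) (toℕ-chip s i)) (digits-low m _ _)

    c-chip : ∀ s i → c (chip s i) ≡ at s
    c-chip s i = trans (c≗ (chip s i)) (low-digits s i)

    d-chip : ∀ s i → d (chip s i) ≡ at s ∷ʳ i
    d-chip s i = begin
      d (chip s i)                                                       ≡⟨ d≗ (chip s i) ⟩
      digits k (suc m) (toℕ (chip s i))                                  ≡⟨ digits-∷ʳ k m (toℕ (chip s i)) ⟩
      digits k m (toℕ (chip s i)) ∷ʳ (dropDigits k m (toℕ (chip s i)) mod k) ≡⟨ cong₂ _∷ʳ_ (low-digits s i) next-digit ⟩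
      at s ∷ʳ i                                                          ∎
      where
      open ≡-Reasoning
      next-digit : dropDigits k m (toℕ (chip s i)) mod k ≡ i
      next-digit = begin
        dropDigits k m (toℕ (chip s i)) mod k         ≡⟨ cong (λ x → dropDigits k m x mod k) (toℕ-chip s i) ⟩
        dropDigits k m (M * toℕ (combine (proj₁ (split s)) i) + toℕ (proj₂ (split s))) mod k
                                                      ≡⟨ cong (_mod k) (dropDigits-high m _ (toℕ<n (proj₂ (split s)))) ⟩
        toℕ (combine (proj₁ (split s)) i) mod k       ≡⟨ cong (_mod k) (Fin.toℕ-combine (proj₁ (split s)) i) ⟩
        (k * toℕ (proj₁ (split s)) + toℕ i) mod k     ≡⟨ [k*y+s]mod-k k (toℕ (proj₁ (split s))) (toℕ i) ⟩
        toℕ i mod k                                   ≡⟨ mod-toℕ k i ⟩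
        i                                             ∎

  module _ (ℓ : ℕ) where

    -- By `digits-rank`, chip x has rank ⌊x / k^m⌋ on its vertex after m rounds, and that number
    -- modulo k is the next digit of x.
    consecutiveRounds-digits : ∀ {m} → m ≤ ℓ → ∀ (x : Fin (k ^ ℓ)) → consecutiveRounds m x ≡ digits k m (toℕ x)
    consecutiveRounds-digits {zero}  _   x = refl
    consecutiveRounds-digits {suc m} m<ℓ x =
      trans (cong₂ (λ v r → v ∷ʳ (r mod k)) (ih x) rank≡) (sym (digits-∷ʳ k m (toℕ x)))
      where
      open ≡-Reasoning
      c : Config k (k ^ ℓ)
      c = consecutiveRounds m
      ih : ∀ y → c y ≡ digits k m (toℕ y)
      ih = consecutiveRounds-digits (<⇒≤ m<ℓ)
      rank≡ : rank c x ≡ dropDigits k m (toℕ x)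
      rank≡ = begin
        rank c x
          ≡⟨ length-filter-filter (λ y → c y ≟ᵥ c x) (Fin._<? x) (allFin (k ^ ℓ)) ⟩
        length (filter (λ y → (c y ≟ᵥ c x) ×-dec (y Fin.<? x)) (allFin (k ^ ℓ)))
          ≡⟨ length-filter-tabulate (λ y → (c y ≟ᵥ c x) ×-dec (y Fin.<? x)) {k ^ ℓ} id ⟩
        ∑[ y < k ^ ℓ ] 𝟙 ((c y ≟ᵥ c x) ×-dec (y Fin.<? x))
          ≡⟨ sum-cong-≗ {k ^ ℓ} (λ y → trans (𝟙-× (c y ≟ᵥ c x) (y Fin.<? x))
               (cong₂ (λ u v → 𝟙 (u ≟ᵥ v) * 𝟙 (y Fin.<? x)) (ih y) (ih x))) ⟩
        ∑[ y < k ^ ℓ ] (𝟙 (digits k m (toℕ y) ≟ᵥ digits k m (toℕ x)) * 𝟙 (toℕ y ℕ.<? toℕ x))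
          ≡⟨ digits-rank k {ℓ} {m} (toℕ x) (<⇒≤ m<ℓ) (toℕ<n x) ⟩
        dropDigits k m (toℕ x) ∎

    consecutiveRounds-reachable : ∀ {m} → m ≤ ℓ → Reachable {k} {k ^ ℓ} (consecutiveRounds m)
    consecutiveRounds-reachable {zero}  _   = ε
    consecutiveRounds-reachable {suc m} m<ℓ = consecutiveRounds-reachable (<⇒≤ m<ℓ)
      ◅◅ fireRound m (ℓ ℕ.∸ suc m) chips-split _ _ (consecutiveRounds-digits (<⇒≤ m<ℓ)) (consecutiveRounds-digits m<ℓ)
      where
      open ≡-Reasoning
      chips-split : k ^ ℓ ≡ k ^ (ℓ ℕ.∸ suc m) * k * k ^ m
      chips-split = begin
        k ^ ℓ                                 ≡⟨ cong (k ^_) (m∸n+n≡m m<ℓ) ⟨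
        k ^ (ℓ ℕ.∸ suc m + suc m)             ≡⟨ ^-distribˡ-+-* k (ℓ ℕ.∸ suc m) (suc m) ⟩
        k ^ (ℓ ℕ.∸ suc m) * (k * k ^ m)       ≡⟨ *-assoc (k ^ (ℓ ℕ.∸ suc m)) k (k ^ m) ⟨
        k ^ (ℓ ℕ.∸ suc m) * k * k ^ m         ∎

    Z-digits : ∀ x → Z k ℓ x ≡ digits k ℓ (toℕ x)
    Z-digits = consecutiveRounds-digits ≤-refl

    Z-reachable : Reachable (Z k ℓ)
    Z-reachable = consecutiveRounds-reachable ≤-refl

    -- Distinct numbers below k^ℓ have distinct strings of ℓ digits, so no vertex holds two chips,
    -- and 1 < k.
    Z-stable : 2 ≤ k → Stable (Z k ℓ)
    Z-stable 2≤k v = ≤-<-trans (≤-trans (≤-reflexive (length-chipsAt (Z k ℓ) v))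
      (sum-𝟙≤1 (λ x → Z k ℓ x ≟ᵥ v) (λ {x} {y} zx zy → toℕ-injective (digits-injective k ℓ (toℕ<n x) (toℕ<n y)
        (trans (sym (Z-digits x)) (trans zx (trans (sym zy) (Z-digits y)))))))) 2≤k

    Z-alternating : (2≤k : 2 ≤ k) {ζ : Permutation′ (k ^ ℓ)} → ReadsAs k ℓ (Z k ℓ) ζ → Alternating k ℓ (ζ ⟨$⟩ʳ_)
    Z-alternating 2≤k {ζ} reads v i j t =
      -- M = 1 and r = 0: before any digit is read, the progression consists of all labels.
      subst₂ _≤_ (sym (count (v ∷ʳ i))) (cong suc (sym (count (v ∷ʳ j)))) (digitCount-alternates k ℓ 1 0 (toℕ t) ≤-refl v i j)
      where
      below = λ x → 𝟙 (x Fin.<? t)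
      count : ∀ u → blockSum ℓ (below ∘ (ζ ⟨$⟩ʳ_)) u ≡ digitCount k ℓ 1 0 (toℕ t) u
      count u = trans (blockSum≡weightBelow 2≤k Z-reachable (Z-stable 2≤k) {ζ} reads below u)
        (sum-cong-≗ {k ^ ℓ} (λ x → cong₂ (λ z w → 𝟙 (z ℕ.<? toℕ t) * inSubtree u w)
          (sym (trans (+-identityʳ _) (+-identityʳ (toℕ x)))) (Z-digits x)))

-- The closed formula and the maximum

open import Data.Integer using (+_)

closed-formula : ∀ k ℓ inv → 4 * inv + (ℓ * k ^ suc ℓ + k ^ ℓ) ≡ k ^ ℓ * k ^ ℓ + ℓ * k ^ ℓ →
  (+ inv) ℚ./ 1 ≡ (+ (k ^ (2 * ℓ)) ℤ.- + ℓ ℤ.* + (k ^ suc ℓ) ℤ.+ (+ ℓ ℤ.- + 1) ℤ.* + (k ^ ℓ)) ℚ./ 4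
-- `mkℚᵘ` stores the denominator minus one, so 0 and 3 stand for 1 and 4; what remains is the
-- cross-multiplied equation in ℤ.
closed-formula k ℓ inv eq = ℚ.fromℚᵘ-cong {mkℚᵘ (+ inv) 0} {mkℚᵘ numerator 3} (*≡* (begin
  + inv ℤ.* + 4
    ≡⟨ solve 3 (λ i b c → i :* con (+ 4) := (con (+ 4) :* i :+ (b :+ c)) :- (b :+ c)) refl
         (+ inv) (+ (ℓ * k ^ suc ℓ)) (+ (k ^ ℓ)) ⟩
  (+ 4 ℤ.* + inv ℤ.+ (+ (ℓ * k ^ suc ℓ) ℤ.+ + (k ^ ℓ))) ℤ.- (+ (ℓ * k ^ suc ℓ) ℤ.+ + (k ^ ℓ))
    ≡⟨ cong (λ x → (x ℤ.+ (+ (ℓ * k ^ suc ℓ) ℤ.+ + (k ^ ℓ))) ℤ.- (+ (ℓ * k ^ suc ℓ) ℤ.+ + (k ^ ℓ))) (ℤ.pos-* 4 inv) ⟨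
  + (4 * inv + (ℓ * k ^ suc ℓ + k ^ ℓ)) ℤ.- (+ (ℓ * k ^ suc ℓ) ℤ.+ + (k ^ ℓ))
    ≡⟨ cong (λ x → + x ℤ.- (+ (ℓ * k ^ suc ℓ) ℤ.+ + (k ^ ℓ))) (trans eq (cong (_+ ℓ * k ^ ℓ) k^ℓ*k^ℓ)) ⟩
  (+ (k ^ (2 * ℓ)) ℤ.+ + (ℓ * k ^ ℓ)) ℤ.- (+ (ℓ * k ^ suc ℓ) ℤ.+ + (k ^ ℓ))
    ≡⟨ cong₂ (λ x y → (+ (k ^ (2 * ℓ)) ℤ.+ x) ℤ.- (y ℤ.+ + (k ^ ℓ))) (ℤ.pos-* ℓ (k ^ ℓ)) (ℤ.pos-* ℓ (k ^ suc ℓ)) ⟩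
  (+ (k ^ (2 * ℓ)) ℤ.+ + ℓ ℤ.* + (k ^ ℓ)) ℤ.- (+ ℓ ℤ.* + (k ^ suc ℓ) ℤ.+ + (k ^ ℓ))
    ≡⟨ solve 4 (λ a b c l → (a :+ l :* c) :- (l :* b :+ c) := (a :- l :* b :+ (l :- con (+ 1)) :* c) :* con (+ 1)) refl
         (+ (k ^ (2 * ℓ))) (+ (k ^ suc ℓ)) (+ (k ^ ℓ)) (+ ℓ) ⟩
  numerator ℤ.* + 1 ∎))
  where
  open ≡-Reasoning
  open ℤ-Solver.+-*-Solver
  numerator = + (k ^ (2 * ℓ)) ℤ.- + ℓ ℤ.* + (k ^ suc ℓ) ℤ.+ (+ ℓ ℤ.- + 1) ℤ.* + (k ^ ℓ)
  k^ℓ*k^ℓ : k ^ ℓ * k ^ ℓ ≡ k ^ (2 * ℓ)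
  k^ℓ*k^ℓ = trans (sym (^-distribˡ-+-* k ℓ ℓ)) (cong (λ m → k ^ (ℓ + m)) (sym (+-identityʳ ℓ)))

⟨$⟩ʳ-injective : ∀ {n} (π : Permutation′ n) → Injective _≡_ _≡_ (π ⟨$⟩ʳ_)
⟨$⟩ʳ-injective π eq = trans (sym (Perm.inverseˡ π)) (trans (cong (π Perm.⟨$⟩ˡ_) eq) (Perm.inverseˡ π))

module _ (k ℓ : ℕ) .{{_ : NonZero k}} (2≤k : 2 ≤ k) where

  Z-inversions : ∀ ζ → ReadsAs k ℓ (Z k ℓ) ζ → 4 * inversions ζ + (ℓ * k ^ suc ℓ + k ^ ℓ) ≡ k ^ ℓ * k ^ ℓ + ℓ * k ^ ℓ
  Z-inversions ζ reads = trans
    (cong (λ x → 4 * x + (ℓ * k ^ suc ℓ + k ^ ℓ)) (inversions≡inversionCount ζ))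
    (alternating-inversionCount ℓ (ζ ⟨$⟩ʳ_) (⟨$⟩ʳ-injective ζ)
      (readsAs⇒dominated 2≤k (Z-reachable k ℓ) (Z-stable k ℓ 2≤k) {ζ} reads) (Z-alternating k ℓ 2≤k {ζ} reads))

  stable-inversions : ∀ {c : Config k (k ^ ℓ)} → Reachable c → Stable c → ∀ π → ReadsAs k ℓ c π →
                      4 * inversions π + (ℓ * k ^ suc ℓ + k ^ ℓ) ≤ k ^ ℓ * k ^ ℓ + ℓ * k ^ ℓ
  stable-inversions reach stable π reads = ≤-trans
    (≤-reflexive (cong (λ x → 4 * x + (ℓ * k ^ suc ℓ + k ^ ℓ)) (inversions≡inversionCount π)))
    (dominated-inversionCount ℓ (π ⟨$⟩ʳ_) (⟨$⟩ʳ-injective π) (readsAs⇒dominated 2≤k reach stable {π} reads))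

theorem6p1 : (k ℓ : ℕ) .{{_ : NonZero k}} → 2 ≤ k →
  Σ[ ζ ∈ Permutation′ (k ^ ℓ) ]
    ( Reachable (Z k ℓ)
    × Stable (Z k ℓ)
    × ReadsAs k ℓ (Z k ℓ) ζ
    × ((c : Config k (k ^ ℓ)) → Reachable c → Stable c →
         Σ[ π ∈ Permutation′ (k ^ ℓ) ]
           (ReadsAs k ℓ c π × inversions π ≤ inversions ζ))
    × (+ inversions ζ) ℚ./ 1 ≡
        (+ (k ^ (2 * ℓ)) ℤ.- + ℓ ℤ.* + (k ^ suc ℓ) ℤ.+ (+ ℓ ℤ.- + 1) ℤ.* + (k ^ ℓ)) ℚ./ 4 )
theorem6p1 k ℓ 2≤k =
  ζ , Z-reachable k ℓ , Z-stable k ℓ 2≤k , ζ-reads , maximal ,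
  closed-formula k ℓ (inversions ζ) (Z-inversions k ℓ 2≤k ζ ζ-reads)
  where
  Z-readsAs : Σ[ π ∈ Permutation′ (k ^ ℓ) ] ReadsAs k ℓ (Z k ℓ) π
  Z-readsAs = stable⇒readsAs {k} {ℓ} 2≤k (Z-reachable k ℓ) (Z-stable k ℓ 2≤k)

  ζ : Permutation′ (k ^ ℓ)
  ζ = proj₁ Z-readsAs

  ζ-reads : ReadsAs k ℓ (Z k ℓ) ζ
  ζ-reads = proj₂ Z-readsAs

  maximal : (c : Config k (k ^ ℓ)) → Reachable c → Stable c →
            Σ[ π ∈ Permutation′ (k ^ ℓ) ] (ReadsAs k ℓ c π × inversions π ≤ inversions ζ)
  maximal c reach stable = π , π-reads , *-cancelˡ-≤ 4 (+-cancelʳ-≤ (ℓ * k ^ suc ℓ + k ^ ℓ) _ _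
    (≤-trans (stable-inversions k ℓ 2≤k reach stable π π-reads) (≤-reflexive (sym (Z-inversions k ℓ 2≤k ζ ζ-reads)))))
    where
    π : Permutation′ (k ^ ℓ)
    π = proj₁ (stable⇒readsAs {k} {ℓ} 2≤k reach stable)
    π-reads : ReadsAs k ℓ c π
    π-reads = proj₂ (stable⇒readsAs {k} {ℓ} 2≤k reach stable)
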